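{- Let $G$ be a $3$-connected planar graph. Then, up to equivalence, $G$ has a unique polyhedral embedding. That is, $G$ has a polyhedral embedding in some orientable surface (of any genus), and any two polyhedral embeddings of $G$ in orientable surfaces (of any, possibly different, genera) are either identical or mirror images of each other.
   Context: Graphs are finite, simple and undirected. A graph is $3$-connected if it has at least $4$ vertices and remains connected after deleting any set of at most $2$ vertices. Embeddings in orientable surfaces are described combinatorially. Each undirected edge $\{u,v\}$ is interpreted as two directed edges $e=(u,v)$ and $e^{ -1}=(v,u)$. An embedding of a graph (with fixed vertex set and edge set) is a choice, for every vertex $u$, of a cyclic order of all directed edges $(u,\cdot)$ starting at $u$ (interpreted as clockwise order). For a directed edge $e$, $\mathrm{nx}(e)$ denotes the next edge after $e$ in the cyclic order around the starting vertex of $e$. The mirror image (inverse) of an embedding is the embedding obtained by reversing all the cyclic orders. Two embeddings of the same graph are equivalent if they are equal or one is the mirror image of the other. A face of an embedding is a directed cyclic walk $e_0,\dots,e_{n-1}$ with $\mathrm{nx}(e_i^{ -1})=e_{(i+1) \bmod n}$ for all $0\le i<n$; i.e. the faces are the orbits of the permutation $e\mapsto \mathrm{nx}(e^{ -1})$ on directed edges. The genus of an embedding of a connected graph with $v$ vertices, $e$ undirected edges and $f$ faces is $\gamma=\frac{2-(v-e+f)}{2}$. A graph is planar if it has an embedding of genus $0$. A polyhedral embedding of a graph in an orientable surface is an embedding such that each facial walk is a simple cycle and the intersection of any two distinct faces (as subgraphs, i.e. their common vertices and edges) is either empty, a single vertex, or a single edge (with its two endpoints). -}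

module Defs where

open import Data.Bool.Base using (Bool; T)
open import Data.Bool.Properties using (T?; T-irrelevant)
open import Data.Fin.Base using (Fin; toℕ; fromℕ<; combine)
open import Data.Fin.Properties as Fin using (pigeonhole; combine-injective; any?; toℕ<n; toℕ-fromℕ<)
open import Data.Fin.Subset using (Subset; ∣_∣; _∉_)
open import Data.Integer.Base as ℤ using (+_)
open import Data.List.Base using (List; length; map; filter; deduplicate; allFin; cartesianProduct; mapMaybe; iterate)
open import Data.List.Relation.Unary.Unique.Propositional using (Unique)
open import Data.Maybe.Base as Maybe using ()
open import Data.Nat.Base as ℕ using (ℕ; zero; suc; _≤_; _<_; _∸_)
open import Data.Nat.DivMod using (_%_; _/_; m≡m%n+[m/n]*n; m%n<n)
open import Data.Nat.GeneralisedArithmetic using (fold; fold-+)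
open import Data.Nat.Properties as ℕ using (m+[n∸m]≡n; n<1+n; ≤-trans; m∸n≤m; m<n⇒0<n∸m)
open import Data.Product.Base using (∃; _×_; _,_; proj₁; proj₂)
open import Data.Rational.Base as ℚ using (ℚ; 0ℚ)
open import Data.Sum.Base using (_⊎_)
open import Function.Base using (_∘_)
open import Function.Bundles using (_↔_; Inverse)
open import Function.Construct.Symmetry using (↔-sym)
open import Function.Definitions using (Injective)
open import Level using (0ℓ)
open import Relation.Binary.Construct.Closure.ReflexiveTransitive using (Star)
open import Relation.Binary.Definitions using (Decidable; DecidableEquality)
open import Relation.Binary.PropositionalEquality
  using (_≡_; refl; sym; trans; cong; subst; module ≡-Reasoning)
open import Relation.Nullary.Decidable.Core using (yes; no; map′; dec⇒maybe)
open import Relation.Nullary.Negation.Core using (¬_)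
open import Relation.Unary using (Pred; _∩_; _∪_; _≐_; ∅; ｛_｝)

------------------------------------------------------------------------
-- Orbits of a permutation of a finite set.  Non-negative iterates
-- suffice, because on a finite set the inverse is itself an iterate.

SameOrbit : {A : Set} → (A → A) → A → A → Set
SameOrbit f a b = ∃ λ k → fold a f k ≡ b

module _ {A : Set} (f : A → A) (f-inj : Injective _≡_ _≡_ f)
         {N : ℕ} (code : A → Fin N) (code-inj : Injective _≡_ _≡_ code) where

  private
    fold-inj : ∀ k {a b} → fold a f k ≡ fold b f k → a ≡ b
    fold-inj zero    eq = eq
    fold-inj (suc k) eq = fold-inj k (f-inj eq)

  period : ∀ a → ∃ λ p → p < N × fold a f (suc p) ≡ a
  period a
    with i , j , i<j , eq ← pigeonhole (n<1+n N) (λ i → code (fold a f (toℕ i)))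
    with toℕ j ∸ toℕ i in d | m<n⇒0<n∸m i<j
  ... | suc p | _ = p , p<N , sym (fold-inj (toℕ i) (trans (code-inj eq) split))
    where
    open ≡-Reasoning
    p<N : p < N
    p<N = subst (_≤ N) d (≤-trans (m∸n≤m (toℕ j) (toℕ i)) (ℕ.s≤s⁻¹ (toℕ<n j)))
    split : fold a f (toℕ j) ≡ fold (fold a f (suc p)) f (toℕ i)
    split = begin
      fold a f (toℕ j)                   ≡⟨ cong (fold a f) (m+[n∸m]≡n (ℕ.<⇒≤ i<j)) ⟨
      fold a f (toℕ i ℕ.+ (toℕ j ∸ toℕ i)) ≡⟨ cong (λ x → fold a f (toℕ i ℕ.+ x)) d ⟩
      fold a f (toℕ i ℕ.+ suc p)         ≡⟨ fold-+ a f (toℕ i) ⟩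
      fold (fold a f (suc p)) f (toℕ i)  ∎

  fold-period* : ∀ {a} p → fold a f p ≡ a → ∀ q → fold a f (q ℕ.* p) ≡ a
  fold-period* p eq zero    = refl
  fold-period* {a} p eq (suc q) =
    trans (fold-+ a f p) (trans (cong (λ z → fold z f p) (fold-period* p eq q)) eq)

  sameOrbit-bounded : ∀ {a b} → SameOrbit f a b → ∃ λ (k : Fin N) → fold a f (toℕ k) ≡ b
  sameOrbit-bounded {a} {b} (k , eq) with p , p<N , per ← period a =
    fromℕ< r<N , trans (cong (fold a f) (toℕ-fromℕ< r<N)) (trans (sym reduce) eq)
    where
    r = k % suc p
    r<N : r < N
    r<N = ≤-trans (m%n<n k (suc p)) p<N
    reduce : fold a f k ≡ fold a f r
    reduce = trans (cong (fold a f) (m≡m%n+[m/n]*n k (suc p)))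
                   (trans (fold-+ a f r)
                          (cong (λ z → fold z f r) (fold-period* (suc p) per (k / suc p))))

  sameOrbit? : DecidableEquality A → Decidable (SameOrbit f)
  sameOrbit? _≟_ a b =
    map′ (λ (k , eq) → toℕ k , eq) sameOrbit-bounded
         (any? (λ k → fold a f (toℕ k) ≟ b))

------------------------------------------------------------------------
-- Graphs

record Graph : Set where
  field
    order  : ℕ
    adj    : Fin order → Fin order → Bool
    symm   : ∀ {u v} → T (adj u v) → T (adj v u)
    irrefl : ∀ {u} → ¬ T (adj u u)

  Vertex : Set
  Vertex = Fin order

open Graph public using (order; Vertex)

module _ (G : Graph) where
  open Graph G using (adj)

  StepOutside : Subset (order G) → Vertex G → Vertex G → Set
  StepOutside S u v = T (adj u v) × u ∉ S × v ∉ S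

  ConnectedWithout : Subset (order G) → Set
  ConnectedWithout S = ∀ u v → u ∉ S → v ∉ S → Star (StepOutside S) u v

  ThreeConnected : Set
  ThreeConnected = 4 ≤ order G × (∀ S → ∣ S ∣ ≤ 2 → ConnectedWithout S)

------------------------------------------------------------------------
-- Directed edges

record Dart (G : Graph) : Set where
  constructor dart
  field
    src      : Vertex G
    tgt      : Vertex G
    adjacent : T (Graph.adj G src tgt)

open Dart public

module _ {G : Graph} where
  open Graph G using (adj; symm)

  rev : Dart G → Dart G
  rev (dart u v p) = dart v u (symm p)

  dart-≡ : ∀ {d d′ : Dart G} → src d ≡ src d′ → tgt d ≡ tgt d′ → d ≡ d′
  dart-≡ refl refl = cong (dart _ _) (T-irrelevant _ _)

  rev-involutive : ∀ d → rev (rev d) ≡ d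
  rev-involutive d = dart-≡ refl refl

  rev-injective : Injective _≡_ _≡_ rev
  rev-injective {d} {d′} eq =
    trans (sym (rev-involutive d)) (trans (cong rev eq) (rev-involutive d′))

  infix 4 _≟ᵈ_
  _≟ᵈ_ : DecidableEquality (Dart G)
  d ≟ᵈ d′ with src d Fin.≟ src d′ | tgt d Fin.≟ tgt d′
  ... | yes p | yes q = yes (dart-≡ p q)
  ... | no ¬p | _     = no (¬p ∘ cong src)
  ... | yes _ | no ¬q = no (¬q ∘ cong tgt)

  code : Dart G → Fin (order G ℕ.* order G)
  code d = combine (src d) (tgt d)

  code-injective : Injective _≡_ _≡_ code
  code-injective {d} {d′} eq
    with p , q ← combine-injective (src d) (tgt d) (src d′) (tgt d′) eq = dart-≡ p q

module _ (G : Graph) where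
  darts : List (Dart G)
  darts = mapMaybe (λ (u , v) → Maybe.map (dart u v) (dec⇒maybe (T? (Graph.adj G u v))))
                   (cartesianProduct (allFin (order G)) (allFin (order G)))

  -- Each undirected edge is counted through its increasing orientation.
  edgeCount : ℕ
  edgeCount = length (filter (λ d → src d Fin.<? tgt d) darts)

DartFrom : (G : Graph) → Vertex G → Set
DartFrom G u = ∃ λ v → T (Graph.adj G u v)

------------------------------------------------------------------------
-- Embeddings

-- A cyclic order on a finite set, given by its successor permutation:
-- all elements lie on one single cycle.
record CyclicOrder (A : Set) : Set where
  field
    perm        : A ↔ A
    singleCycle : ∀ a b → SameOrbit (Inverse.to perm) a b

  next : A → A
  next = Inverse.to perm

reverse : {A : Set} → CyclicOrder A → CyclicOrder A
reverse {A} c = record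
  { perm        = ↔-sym perm
  ; singleCycle = λ a b → let k , eq = singleCycle b a in
                          k , trans (cong (λ z → fold z from k) (sym eq)) (undo k b)
  }
  where
  open CyclicOrder c
  open Inverse perm using (to; from; strictlyInverseʳ)

  fold-shift : ∀ k a → fold (from a) from k ≡ from (fold a from k)
  fold-shift zero    a = refl
  fold-shift (suc k) a = cong from (fold-shift k a)

  undo : ∀ k b → fold (fold b to k) from k ≡ b
  undo zero    b = refl
  undo (suc k) b =
    trans (sym (fold-shift k (to (fold b to k))))
          (trans (cong (λ z → fold z from k) (strictlyInverseʳ (fold b to k))) (undo k b))

record Embedding (G : Graph) : Set where
  field
    rotation : ∀ u → CyclicOrder (DartFrom G u)

open Embedding public

mirror : {G : Graph} → Embedding G → Embedding G
mirror E = record { rotation = λ u → reverse (rotation E u) }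

module _ {G : Graph} (E : Embedding G) where

  nx : Dart G → Dart G
  nx (dart u v p) = let w , q = CyclicOrder.next (rotation E u) (v , p) in dart u w q

  nx-injective : Injective _≡_ _≡_ nx
  nx-injective {dart u v p} {dart u′ v′ p′} eq with refl ← cong src eq =
    dart-≡ refl (cong proj₁ (to-inj (v , p) (v′ , p′) (cong tgt eq)))
    where
    open Inverse (CyclicOrder.perm (rotation E u)) using (to; from; strictlyInverseʳ)
    pair : ∀ {x y : DartFrom G u} → proj₁ x ≡ proj₁ y → x ≡ y
    pair refl = cong (_ ,_) (T-irrelevant _ _)
    to-inj : ∀ x y → proj₁ (to x) ≡ proj₁ (to y) → x ≡ y
    to-inj x y e =
      trans (sym (strictlyInverseʳ x)) (trans (cong from (pair e)) (strictlyInverseʳ y))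

  faceNext : Dart G → Dart G
  faceNext e = nx (rev e)

  faceNext-injective : Injective _≡_ _≡_ faceNext
  faceNext-injective = rev-injective ∘ nx-injective

  SameFace : Dart G → Dart G → Set
  SameFace = SameOrbit faceNext

  sameFace? : Decidable SameFace
  sameFace? = sameOrbit? faceNext faceNext-injective code code-injective _≟ᵈ_

  faceCount : ℕ
  faceCount = length (deduplicate sameFace? (darts G))

  -- Meaningful for connected graphs with at least one edge: the empty
  -- face of an edgeless embedding is not an orbit of darts.
  genus : ℚ
  genus = (+ 2 ℤ.- ((+ order G ℤ.- + edgeCount G) ℤ.+ + faceCount)) ℚ./ 2

  -- The number of darts on the face through d, i.e. its orbit size.
  faceLength : Dart G → ℕ
  faceLength d = length (filter (sameFace? d) (darts G))

  facialWalk : Dart G → List (Dart G)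
  facialWalk d = iterate faceNext d (faceLength d)

Planar : Graph → Set
Planar G = ∃ λ (E : Embedding G) → genus E ≡ 0ℚ

infix 4 _≗ᴱ_
_≗ᴱ_ : ∀ {G} → Embedding G → Embedding G → Set
E ≗ᴱ E′ = ∀ d → nx E d ≡ nx E′ d

Equivalent : ∀ {G} → Embedding G → Embedding G → Set
Equivalent E E′ = E ≗ᴱ E′ ⊎ E ≗ᴱ mirror E′

------------------------------------------------------------------------
-- Polyhedral embeddings

-- For a closed walk, given by the list of its directed edges.
IsSimpleCycle : ∀ {G} → List (Dart G) → Set
IsSimpleCycle w = 3 ≤ length w × Unique (map src w)

-- An undirected edge is represented by both of its orientations, so
-- edge predicates are intended to be closed under rev.
record Subgraph (G : Graph) : Set₁ where
  field
    vertices : Pred (Vertex G) 0ℓ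
    edges    : Pred (Dart G) 0ℓ

open Subgraph public

module _ {G : Graph} where

  infix 4 _≐ᴳ_
  _≐ᴳ_ : Subgraph G → Subgraph G → Set
  H ≐ᴳ K = vertices H ≐ vertices K × edges H ≐ edges K

  infixr 7 _∩ᴳ_
  _∩ᴳ_ : Subgraph G → Subgraph G → Subgraph G
  H ∩ᴳ K = record { vertices = vertices H ∩ vertices K ; edges = edges H ∩ edges K }

  emptySubgraph : Subgraph G
  emptySubgraph = record { vertices = ∅ ; edges = ∅ }

  singleVertex : Vertex G → Subgraph G
  singleVertex u = record { vertices = ｛ u ｝ ; edges = ∅ }

  singleEdge : Dart G → Subgraph G
  singleEdge e = record
    { vertices = ｛ src e ｝ ∪ ｛ tgt e ｝
    ; edges    = ｛ e ｝ ∪ ｛ rev e ｝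
    }

  faceSubgraph : Embedding G → Dart G → Subgraph G
  faceSubgraph E d = record
    { vertices = λ u → ∃ λ e → SameFace E d e × src e ≡ u
    ; edges    = λ e → SameFace E d e ⊎ SameFace E d (rev e)
    }

  Polyhedral : Embedding G → Set
  Polyhedral E =
    (∀ d → IsSimpleCycle (facialWalk E d)) ×
    (∀ d d′ → ¬ SameFace E d d′ →
      let I = faceSubgraph E d ∩ᴳ faceSubgraph E d′ in
      I ≐ᴳ emptySubgraph
      ⊎ (∃ λ u → I ≐ᴳ singleVertex u)
      ⊎ (∃ λ e → I ≐ᴳ singleEdge e))

{-# OPTIONS --safe #-}
module Submission where

-- Let E₀ be an embedding of genus 0.  By Euler's formula the dimension of the
-- space of coboundaries of face colourings of E₀ modulo 2 equals that of the
-- cycle space, so every cycle is such a coboundary: a combinatorial Jordan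
-- curve theorem.
--
-- E₀ is polyhedral: if two corners at a vertex belonged to the same face, or
-- to two faces meeting again at a vertex that they do not share an edge with,
-- then 3-connectedness would give a cycle that separates the corners at this
-- vertex and avoids the other one.
--
-- For uniqueness, let F be a face of a polyhedral embedding E and colour the
-- faces of E₀ with coboundary F.  As the faces of E next to F only meet F in a
-- vertex or an edge, all darts off F have the same colour.  The darts of the
-- other colour lie on F, so a face of E₀ of this colour is F, traversed in one
-- of the two directions.  As all degrees are at least 3, the direction is the
-- same for all faces of E.

open import Defs
open import Algebra.Bundles using (CommutativeRing)
open import Data.Bool.Base using (Bool; true; false; not; T; _∧_; _xor_)
open import Data.Bool.Properties as Bool
  using (T?; T-irrelevant; xor-∧-commutativeRing; xor-same; xor-comm; xor-assoc; ∧-zeroʳ; ¬-not; not-¬)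
open import Data.Empty using (⊥; ⊥-elim)
open import Data.Fin.Base as Fin using (Fin; zero; suc; _↑ˡ_; _↑ʳ_; splitAt; punchOut; funToFin; finToFun)
open import Data.Fin.Properties as Fin
  using (2↔Bool; finToFun-funToFin; funToFin-finToFin; any?; punchOut-injective; injective⇒≤;
         splitAt⁻¹-↑ˡ; splitAt⁻¹-↑ʳ; suc-injective)
open import Data.Fin.Subset
  using (Subset; ∣_∣; _∈_; _∉_; ⁅_⁆; inside; outside) renaming (_∪_ to _∪ˢ_; ⊥ to ∅ˢ)
open import Data.Fin.Subset.Properties
  using (∣⁅x⁆∣≡1; ∣⊥∣≡0; ∉⊥; x∈⁅x⁆; x∈⁅y⁆⇒x≡y; x∈p∪q⁺; x∈p∪q⁻)
open import Data.Integer.Base as ℤ using (+_)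
import Data.Integer.Properties as ℤ
open import Data.Integer.Tactic.RingSolver renaming (solve-∀ to ℤ-solve-∀)
open import Data.List.Base
  using (List; []; _∷_; length; lookup; map; filter; deduplicate; mapMaybe; iterate)
open import Data.List.Membership.Propositional as L using (find; lose)
open import Data.List.Membership.Propositional.Properties as L
  using (∈-lookup; ∈-allFin; ∈-cartesianProduct⁺; ∈-filter⁺; ∈-filter⁻)
import Data.List.Membership.Setoid.Properties as SetoidMembership
open import Data.List.Properties using (length-tabulate; length-iterate)
open import Data.List.Relation.Unary.All as All using (All; []; _∷_)
import Data.List.Relation.Unary.All.Properties as All
open import Data.List.Relation.Unary.AllPairs using (AllPairs; []; _∷_)
open import Data.List.Relation.Unary.Any as Any using (Any; here; there; index)
open import Data.List.Relation.Unary.Any.Properties using (lookup-index)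
open import Data.List.Relation.Unary.Unique.Propositional using (Unique)
import Data.List.Relation.Unary.Unique.Propositional.Properties as Unique
import Data.List.Relation.Unary.Unique.DecSetoid.Properties as UniqueDec
open import Data.Maybe.Base as Maybe using (Maybe; just; nothing)
import Data.Maybe.Relation.Unary.All as MaybeAll
open import Data.Nat.Base as ℕ using (ℕ; zero; suc; _≤_; _<_; z≤n; s≤s)
open import Data.Nat.GeneralisedArithmetic using (fold; fold-+)
import Data.Nat.Properties as ℕ
open import Data.Product.Base using (∃; _×_; _,_; proj₁; proj₂)
open import Data.Rational.Base as ℚ using (0ℚ)
open import Data.Rational.Properties using (/-injective-≃)
open import Data.Rational.Unnormalised.Base using (mkℚᵘ; *≡*)
open import Data.Sum.Base as Sum using (_⊎_; inj₁; inj₂)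
open import Data.Vec.Base using ([]; _∷_)
open import Function.Base using (_∘_; id)
open import Function.Bundles using (Inverse; mk↔ₛ′)
open import Function.Definitions using (Injective)
open import Level using (0ℓ)
open import Relation.Binary.Bundles using (DecSetoid)
open import Relation.Binary.Construct.Closure.ReflexiveTransitive using (Star; ε; _◅_)
open import Relation.Binary.Definitions using (tri<; tri≈; tri>)
open import Relation.Binary.PropositionalEquality
  using (_≡_; _≢_; _≗_; refl; sym; trans; cong; cong₂; subst; module ≡-Reasoning)
open import Relation.Nullary.Decidable
  using (Dec; yes; no; ⌊_⌋; decidable-stable; ¬?; dec⇒maybe; dec-true; dec-false; isYes≗does; map′;
         _×-dec_; _⊎-dec_)
open import Relation.Nullary.Negation using (¬_; contradiction)

open CommutativeRing xor-∧-commutativeRing using (+-commutativeMonoid; +-commutativeSemigroup)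
open import Algebra.Properties.CommutativeSemigroup +-commutativeSemigroup using (interchange)
open import Algebra.Properties.CommutativeMonoid.Sum +-commutativeMonoid
  using (sum; sum-cong-≗; ∑-distrib-+; sum-permute; sum-replicate-zero)

-- Exclusive or

xor≡false⇒≡ : ∀ {a b} → a xor b ≡ false → a ≡ b
xor≡false⇒≡ {false} {false} _ = refl
xor≡false⇒≡ {true}  {true}  _ = refl

≡⇒xor≡false : ∀ {a b} → a ≡ b → a xor b ≡ false
≡⇒xor≡false {a} refl = xor-same a

xor≡true⇒≡not : ∀ {a b} → a xor b ≡ true → b ≡ not a
xor≡true⇒≡not {false} {true}  _ = refl
xor≡true⇒≡not {true}  {false} _ = refl

sum-false : ∀ {n} {f : Fin n → Bool} → (∀ i → f i ≡ false) → sum f ≡ false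
sum-false {n} f≗false = trans (sum-cong-≗ f≗false) (sum-replicate-zero n)

sum-single : ∀ {n} (f : Fin n → Bool) i → (∀ j → j ≢ i → f j ≡ false) → sum f ≡ f i
sum-single {suc n} f zero    off = trans (cong (f zero xor_) (sum-false λ j → off (suc j) λ ()))
                                         (Bool.xor-identityʳ (f zero))
sum-single {suc n} f (suc i) off = trans (cong (_xor sum (f ∘ suc)) (off zero λ ()))
  (sum-single (f ∘ suc) i λ j j≢i → off (suc j) (j≢i ∘ suc-injective))

indicator : ∀ {n} → Fin n → Fin n → Bool
indicator v u = ⌊ u Fin.≟ v ⌋

indicator-≡ : ∀ {n} {v u : Fin n} → u ≡ v → indicator v u ≡ true
indicator-≡ {v = v} {u} eq = trans (isYes≗does (u Fin.≟ v)) (dec-true (u Fin.≟ v) eq)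

indicator-≢ : ∀ {n} {v u : Fin n} → u ≢ v → indicator v u ≡ false
indicator-≢ {v = v} {u} ne = trans (isYes≗does (u Fin.≟ v)) (dec-false (u Fin.≟ v) ne)

-- Finite sets

-- A missed value `y` could be punched out, which would inject `Fin (suc n)` into `Fin n`.
injective⇒surjective : ∀ {n} (g : Fin n → Fin n) → Injective _≡_ _≡_ g → ∀ y → ∃ λ x → g x ≡ y
injective⇒surjective {suc n} g g-inj y with any? (λ x → g x Fin.≟ y)
... | yes found = found
... | no missed = contradiction (injective⇒≤ skip-inj) ℕ.1+n≰n
  where
  y≢g : ∀ x → y ≢ g x
  y≢g x y≡gx = missed (x , sym y≡gx)
  skip : Fin (suc n) → Fin n
  skip x = punchOut (y≢g x)
  skip-inj : Injective _≡_ _≡_ skip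
  skip-inj eq = g-inj (punchOut-injective (y≢g _) (y≢g _) eq)

module _ {n : ℕ} where
  open Inverse 2↔Bool using (to; from; strictlyInverseˡ)

  private
    encode : (Fin n → Bool) → Fin (2 ℕ.^ n)
    encode x = funToFin (from ∘ x)

    decode : Fin (2 ℕ.^ n) → Fin n → Bool
    decode k = to ∘ finToFun k

    decode-encode : ∀ x → decode (encode x) ≗ x
    decode-encode x i = trans (cong to (finToFun-funToFin (from ∘ x) i)) (strictlyInverseˡ (x i))

    funToFin-cong : ∀ {m k} {f g : Fin m → Fin k} → f ≗ g → funToFin f ≡ funToFin g
    funToFin-cong {zero}  eq = refl
    funToFin-cong {suc m} eq = cong₂ Fin.combine (eq zero) (funToFin-cong (eq ∘ suc))

    decode-injective : ∀ {k l} → decode k ≗ decode l → k ≡ l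
    decode-injective {k} {l} eq = begin
      k                              ≡⟨ funToFin-finToFin {n} k ⟨
      funToFin {n} (finToFun k)      ≡⟨ funToFin-cong {n} (λ i → to-injective (eq i)) ⟩
      funToFin {n} (finToFun l)      ≡⟨ funToFin-finToFin {n} l ⟩
      l                              ∎
      where
      open ≡-Reasoning
      to-injective : ∀ {a b} → to a ≡ to b → a ≡ b
      to-injective {a} {b} e = trans (sym (Inverse.strictlyInverseʳ 2↔Bool a))
                                     (trans (cong from e) (Inverse.strictlyInverseʳ 2↔Bool b))

  -- Counting takes the place of linear algebra: `encode` and `decode` identify both sides with the
  -- numbers below `2 ^ n`, where injective maps are surjective.
  injective⇒surjective-→Bool : ∀ {m} → m ≡ n → (F : (Fin m → Bool) → (Fin n → Bool)) →
    (∀ x y → F x ≗ F y → x ≗ y) → ∀ y → ∃ λ x → F x ≗ y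
  injective⇒surjective-→Bool refl F F-inj y
    = decode (proj₁ preimage) , encode-injective (proj₂ preimage)
    where
    encode-injective : ∀ {x y} → encode x ≡ encode y → x ≗ y
    encode-injective {x} {y} eq i =
      trans (sym (decode-encode x i)) (trans (cong (λ z → decode z i) eq) (decode-encode y i))
    encoded-injective : Injective _≡_ _≡_ (encode ∘ F ∘ decode)
    encoded-injective eq = decode-injective (F-inj _ _ (encode-injective eq))
    preimage = injective⇒surjective (encode ∘ F ∘ decode) encoded-injective (encode y)

-- A finite set Fin n with n = 1 + m, viewed as Fin m with an additional
-- base point at which extended functions vanish.
record Pointed (n m : ℕ) : Set where
  field
    base            : Fin n
    point           : Fin m → Fin n
    point-injective : Injective _≡_ _≡_ point
    point≢base      : ∀ j → point j ≢ base
    extend          : (Fin m → Bool) → Fin n → Bool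
    extend-base     : ∀ x → extend x base ≡ false
    extend-point    : ∀ x j → extend x (point j) ≡ x j

pointed : ∀ {n m} → n ≡ suc m → Pointed n m
pointed refl = record
  { base = zero ; point = suc ; point-injective = suc-injective ; point≢base = λ _ ()
  ; extend = λ { x zero → false ; x (suc j) → x j }
  ; extend-base = λ _ → refl ; extend-point = λ _ _ → refl }

-- Lists

AllPairs-lookup : ∀ {A : Set} {R : A → A → Set} → (∀ {x y} → R x y → R y x) →
                  ∀ {xs} → AllPairs (λ x y → ¬ R x y) xs →
                  ∀ i j → R (lookup xs i) (lookup xs j) → i ≡ j
AllPairs-lookup s (_  ∷ _)  zero    zero    r = refl
AllPairs-lookup s (px ∷ _)  zero    (suc j) r = contradiction r (All.lookup px (∈-lookup j))
AllPairs-lookup s (px ∷ _)  (suc i) zero    r = contradiction (s r) (All.lookup px (∈-lookup i))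
AllPairs-lookup s (_  ∷ ps) (suc i) (suc j) r = cong suc (AllPairs-lookup s ps i j r)

Unique-⊆⇒length≤ : ∀ {A : Set} {xs ys : List A} → Unique xs →
                   (∀ {x} → x L.∈ xs → x L.∈ ys) → length xs ≤ length ys
Unique-⊆⇒length≤ {xs = xs} {ys} uniq xs⊆ys = injective⇒≤ {f = position} position-injective
  where
  position : Fin (length xs) → Fin (length ys)
  position i = index (xs⊆ys (∈-lookup i))
  position-injective : Injective _≡_ _≡_ position
  position-injective {i} {j} eq = AllPairs-lookup sym uniq i j
    (trans (lookup-index (xs⊆ys (∈-lookup i)))
      (trans (cong (lookup ys) eq) (sym (lookup-index (xs⊆ys (∈-lookup j))))))

Unique-mapMaybe⁺ : ∀ {A B : Set} (f : A → Maybe B) →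
                   (∀ {x y b} → f x ≡ just b → f y ≡ just b → x ≡ y) →
                   ∀ {xs} → Unique xs → Unique (mapMaybe f xs)
Unique-mapMaybe⁺ f inj [] = []
Unique-mapMaybe⁺ f inj {x ∷ xs} (x∉xs ∷ uniq) with f x in fx
... | nothing = Unique-mapMaybe⁺ f inj uniq
... | just b  = All.mapMaybe⁺ (All.map⁺ (All.map fresh x∉xs)) ∷ Unique-mapMaybe⁺ f inj uniq
  where
  fresh : ∀ {y} → x ≢ y → MaybeAll.All (b ≢_) (f y)
  fresh {y} x≢y with f y in fy
  ... | nothing = MaybeAll.nothing
  ... | just c  = MaybeAll.just λ where refl → x≢y (inj fx fy)

∈-mapMaybe⁺ : ∀ {A B : Set} (f : A → Maybe B) {xs x b} → x L.∈ xs → f x ≡ just b → b L.∈ mapMaybe f xs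
∈-mapMaybe⁺ f {x ∷ xs} (here refl) eq rewrite eq = here refl
∈-mapMaybe⁺ f {y ∷ xs} (there x∈xs) eq with f y
... | nothing = ∈-mapMaybe⁺ f x∈xs eq
... | just _  = there (∈-mapMaybe⁺ f x∈xs eq)

-- Orbits

module _ {A : Set} (f : A → A) where

  fold-shift : ∀ a k → fold (f a) f k ≡ f (fold a f k)
  fold-shift a zero    = refl
  fold-shift a (suc k) = cong f (fold-shift a k)

  orbit-refl : ∀ {a} → SameOrbit f a a
  orbit-refl = 0 , refl

  orbit-trans : ∀ {a b c} → SameOrbit f a b → SameOrbit f b c → SameOrbit f a c
  orbit-trans {a} (k , refl) (l , eq) = l ℕ.+ k , trans (fold-+ a f l) eq

  orbit-step : ∀ {a b} → SameOrbit f a b → SameOrbit f a (f b)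
  orbit-step (k , eq) = suc k , cong f eq

  orbit-ind : ∀ {a b} (P : A → Set) → P a → (∀ {y} → SameOrbit f a y → P y → P (f y)) →
              SameOrbit f a b → P b
  orbit-ind {a} P base step (k , refl) = go k
    where
    go : ∀ k → P (fold a f k)
    go zero    = base
    go (suc k) = step (k , refl) (go k)

  orbit-invariant : {B : Set} (g : A → B) → (∀ x → g (f x) ≡ g x) →
                    ∀ {a b} → SameOrbit f a b → g a ≡ g b
  orbit-invariant g inv {a} = orbit-ind (λ y → g a ≡ g y) refl (λ _ e → trans e (sym (inv _)))

  orbit-ind-back : ∀ {a b} (P : A → Set) → P b → (∀ {y} → SameOrbit f a y → P (f y) → P y) →
                   SameOrbit f a b → P a
  orbit-ind-back {a} P base step (k , refl) = go k base
    where
    go : ∀ k → P (fold a f k) → P a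
    go zero    p = p
    go (suc k) p = go k (step (k , refl) p)

  fold-< : ∀ {a b} p → fold a f (suc p) ≡ a → SameOrbit f a b → ∃ λ r → r < suc p × fold a f r ≡ b
  fold-< {a} p per = orbit-ind (λ y → ∃ λ r → r < suc p × fold a f r ≡ y) (0 , s≤s z≤n , refl) step
    where
    step : ∀ {y} → SameOrbit f a y → (∃ λ r → r < suc p × fold a f r ≡ y) →
           ∃ λ r → r < suc p × fold a f r ≡ f y
    step _ (r , r<p , refl) with ℕ.m≤n⇒m<n∨m≡n r<p
    ... | inj₁ 1+r<p = suc r , 1+r<p , refl
    ... | inj₂ refl  = 0 , s≤s z≤n , sym per

-- Rotations and faces

module _ {G : Graph} where
  open Graph G using (adj; irrefl)

  dartFrom-≡ : ∀ {u} {x y : DartFrom G u} → proj₁ x ≡ proj₁ y → x ≡ y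
  dartFrom-≡ refl = cong (_ ,_) (T-irrelevant _ _)

  src≢tgt : (d : Dart G) → src d ≢ tgt d
  src≢tgt (dart u .u p) refl = irrefl p

  ∈-darts : (d : Dart G) → d L.∈ darts G
  ∈-darts d@(dart u v p) = ∈-mapMaybe⁺ _ (∈-cartesianProduct⁺ (∈-allFin u) (∈-allFin v)) found
    where
    found : Maybe.map (dart u v) (dec⇒maybe (T? (adj u v))) ≡ just d
    found with T? (adj u v)
    ... | yes q = cong just (dart-≡ refl refl)
    ... | no ¬q = contradiction p ¬q

  darts-unique : Unique (darts G)
  darts-unique = Unique-mapMaybe⁺ _ (λ {x} {y} → inj {x} {y})
    (Unique.cartesianProduct⁺ (Unique.allFin⁺ _) (Unique.allFin⁺ _))
    where
    inj : ∀ {x y : Vertex G × Vertex G} {b} →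
          Maybe.map (dart (proj₁ x) (proj₂ x)) (dec⇒maybe (T? (adj (proj₁ x) (proj₂ x)))) ≡ just b →
          Maybe.map (dart (proj₁ y) (proj₂ y)) (dec⇒maybe (T? (adj (proj₁ y) (proj₂ y)))) ≡ just b →
          x ≡ y
    inj {u , v} {u′ , v′} e e′ with T? (adj u v) | T? (adj u′ v′)
    inj refl refl | yes _ | yes _ = refl

module _ {G : Graph} (E : Embedding G) where

  nx-orbit : ∀ {d d′} → src d ≡ src d′ → SameOrbit (nx E) d d′
  nx-orbit {dart u v p} {dart .u w q} refl
    with k , eq ← CyclicOrder.singleCycle (rotation E u) (v , p) (w , q)
    = k , trans (commute k) (dart-≡ refl (cong proj₁ eq))
    where
    next = CyclicOrder.next (rotation E u)
    toDart : DartFrom G u → Dart G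
    toDart (v , p) = dart u v p
    commute : ∀ k → fold (dart u v p) (nx E) k ≡ toDart (fold (v , p) next k)
    commute zero    = refl
    commute (suc k) = cong (nx E) (commute k)

  -- Induction along the orbit: a step from `y` to its successor can be undone, because going on
  -- round the finite orbit leads back to `y`.
  face-sym : ∀ {d d′} → SameFace E d d′ → SameFace E d′ d
  face-sym {d} = orbit-ind (faceNext E) (λ y → SameFace E y d) (orbit-refl (faceNext E))
    λ {y} _ y~d → let p , _ , per = period (faceNext E) (faceNext-injective E) code code-injective y in
      orbit-trans (faceNext E) (p , trans (fold-shift (faceNext E) y p) per) y~d

  faceSetoid : DecSetoid 0ℓ 0ℓ
  faceSetoid = record
    { Carrier = Dart G
    ; _≈_ = SameFace E
    ; isDecEquivalence = record
      { isEquivalence = record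
        { refl = orbit-refl (faceNext E) ; sym = face-sym ; trans = orbit-trans (faceNext E) }
      ; _≟_ = sameFace? E } }

  FaceColouring : (Dart G → Bool) → Set
  FaceColouring χ = ∀ d → χ (faceNext E d) ≡ χ d

  nx-faceNext : ∀ d → nx E d ≡ faceNext E (rev d)
  nx-faceNext d = cong (nx E) (sym (rev-involutive d))

  -- `nx E d` follows `rev d` on a face, the one in the corner between `d` and `nx E d`.
  rev-nx-face : ∀ d → SameFace E (nx E d) (rev d)
  rev-nx-face d = face-sym (1 , sym (nx-faceNext d))

  colour-nx : ∀ {χ} → FaceColouring χ → ∀ d → χ (nx E d) ≡ χ (rev d)
  colour-nx {χ} inv d = trans (cong χ (nx-faceNext d)) (inv (rev d))

  representatives : List (Dart G)
  representatives = deduplicate (sameFace? E) (darts G)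

  private
    ∈-representatives : ∀ d → Any (SameFace E d) representatives
    ∈-representatives d = SetoidMembership.∈-deduplicate⁺ (DecSetoid.setoid faceSetoid) (sameFace? E)
      (λ y≈z z≈x → orbit-trans (faceNext E) z≈x (face-sym y≈z))
      (Any.map (λ where refl → orbit-refl (faceNext E)) (∈-darts d))

  faceIndex : Dart G → Fin (faceCount E)
  faceIndex d = index (∈-representatives d)

  lookup-faceIndex : ∀ d → SameFace E d (lookup representatives (faceIndex d))
  lookup-faceIndex d = lookup-index (∈-representatives d)

  representatives-injective : ∀ i j → SameFace E (lookup representatives i) (lookup representatives j) → i ≡ j
  representatives-injective = AllPairs-lookup face-sym (UniqueDec.deduplicate-! faceSetoid (darts G))

  faceIndex-lookup : ∀ i → faceIndex (lookup representatives i) ≡ i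
  faceIndex-lookup i = representatives-injective _ _ (face-sym (lookup-faceIndex _))

  faceIndex-cong : ∀ {d d′} → SameFace E d d′ → faceIndex d ≡ faceIndex d′
  faceIndex-cong d~d′ = representatives-injective _ _
    (orbit-trans (faceNext E) (face-sym (lookup-faceIndex _))
      (orbit-trans (faceNext E) d~d′ (lookup-faceIndex _)))

-- Chains modulo 2

module _ {G : Graph} where
  open Graph G using (adj)

  -- Extension by zero to all pairs of vertices, so that boundaries become sums over
  -- `Fin (order G)`.
  entry : (Dart G → Bool) → Vertex G → Vertex G → Bool
  entry Z u v with T? (adj u v)
  ... | yes p = Z (dart u v p)
  ... | no _  = false

  entry-dart : ∀ Z d → entry Z (src d) (tgt d) ≡ Z d
  entry-dart Z (dart u v p) with T? (adj u v)
  ... | yes q = cong Z (dart-≡ refl refl)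
  ... | no ¬q = contradiction p ¬q

  -- The boundary of a chain modulo 2, a chain being a dart function
  -- that is invariant under rev.
  ∂ : (Dart G → Bool) → Vertex G → Bool
  ∂ Z u = sum (entry Z u)

  ∂-cong : ∀ {Z W} → Z ≗ W → ∀ u → ∂ Z u ≡ ∂ W u
  ∂-cong {Z} {W} eq u = sum-cong-≗ λ v → go v
    where
    go : ∀ v → entry Z u v ≡ entry W u v
    go v with T? (adj u v)
    ... | yes p = eq _
    ... | no _  = refl

  ∂-xor : ∀ Z W u → ∂ (λ d → Z d xor W d) u ≡ ∂ Z u xor ∂ W u
  ∂-xor Z W u = trans (sum-cong-≗ go) (∑-distrib-+ (entry Z u) (entry W u))
    where
    go : ∀ v → entry (λ d → Z d xor W d) u v ≡ entry Z u v xor entry W u v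
    go v with T? (adj u v)
    ... | yes p = refl
    ... | no _  = refl

  ∂-∧ : ∀ b Z u → ∂ (λ d → b ∧ Z d) u ≡ b ∧ ∂ Z u
  ∂-∧ true  Z u = ∂-cong (λ _ → refl) u
  ∂-∧ false Z u = sum-false go
    where
    go : ∀ v → entry (λ _ → false) u v ≡ false
    go v with T? (adj u v)
    ... | yes p = refl
    ... | no _  = refl

  ∂-sum : ∀ {n} (Z : Fin n → Dart G → Bool) u → ∂ (λ d → sum (λ i → Z i d)) u ≡ sum (λ i → ∂ (Z i) u)
  ∂-sum {zero}  Z u = ∂-∧ false (λ _ → true) u
  ∂-sum {suc n} Z u = trans (∂-xor (Z zero) (λ d → sum (λ i → Z (suc i) d)) u)
                            (cong (∂ (Z zero) u xor_) (∂-sum (Z ∘ suc) u))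

  along : Dart G → Dart G → Bool
  along x d = indicator (src x) (src d) ∧ indicator (tgt x) (tgt d)

  edgeChain : Dart G → Dart G → Bool
  edgeChain x d = along x d xor along (rev x) d

  ∂-along : ∀ x u → ∂ (along x) u ≡ indicator (src x) u
  ∂-along x u with u Fin.≟ src x in eq
  ... | no  u≢s = sum-false go
    where
    go : ∀ v → entry (along x) u v ≡ false
    go v with T? (adj u v)
    ... | yes p = cong (_∧ indicator (tgt x) v) (indicator-≢ u≢s)
    ... | no _  = refl
  ... | yes refl = trans (sum-single (entry (along x) u) (tgt x) go)
                    (trans (entry-dart (along x) x)
                      (cong₂ _∧_ (indicator-≡ {v = src x} refl) (indicator-≡ {v = tgt x} refl)))
    where
    go : ∀ v → v ≢ tgt x → entry (along x) u v ≡ false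
    go v v≢t with T? (adj u v)
    ... | yes p = trans (cong (indicator (src x) u ∧_) (indicator-≢ v≢t)) (∧-zeroʳ _)
    ... | no _  = refl

  ∂-edgeChain : ∀ x u → ∂ (edgeChain x) u ≡ indicator (src x) u xor indicator (tgt x) u
  ∂-edgeChain x u = trans (∂-xor (along x) (along (rev x)) u) (cong₂ _xor_ (∂-along x u) (∂-along (rev x) u))

  along-rev : ∀ x d → along x (rev d) ≡ along (rev x) d
  along-rev x d = Bool.∧-comm (indicator (src x) (tgt d)) _

  edgeChain-rev : ∀ x d → edgeChain x (rev d) ≡ edgeChain x d
  edgeChain-rev x d = trans (cong₂ _xor_ (along-rev x d) (along-rev (rev x) d))
                            (xor-comm (along (rev x) d) (along x d))

  pathChain : ∀ {S u v} → Star (StepOutside G S) u v → Dart G → Bool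
  pathChain ε d = false
  pathChain ((p , _) ◅ w) d = edgeChain (dart _ _ p) d xor pathChain w d

  -- Modulo 2 the inner vertices of the walk cancel.
  ∂-pathChain : ∀ {S s t} (w : Star (StepOutside G S) s t) u →
                ∂ (pathChain w) u ≡ indicator s u xor indicator t u
  ∂-pathChain {s = s} ε u = trans (∂-∧ false (λ _ → true) u) (sym (xor-same (indicator s u)))
  ∂-pathChain {s = s} {t} (_◅_ {j = j} (p , _) w) u =
    trans (∂-xor (edgeChain (dart _ _ p)) (pathChain w) u)
      (trans (cong₂ _xor_ (∂-edgeChain (dart _ _ p) u) (∂-pathChain w u))
        (telescope (indicator s u) (indicator j u) (indicator t u)))
    where
    telescope : ∀ a b c → (a xor b) xor (b xor c) ≡ a xor c
    telescope false b c = trans (sym (xor-assoc b b c)) (cong (_xor c) (xor-same b))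
    telescope true false c = refl
    telescope true true c = refl

  pathChain-rev : ∀ {S s t} (w : Star (StepOutside G S) s t) d → pathChain w (rev d) ≡ pathChain w d
  pathChain-rev ε d = refl
  pathChain-rev ((p , _) ◅ w) d = cong₂ _xor_ (edgeChain-rev (dart _ _ p) d) (pathChain-rev w d)

  pathChain-outside : ∀ {S s t} (w : Star (StepOutside G S) s t) {d} → src d ∈ S → pathChain w d ≡ false
  pathChain-outside ε _ = refl
  pathChain-outside {S} ((p , s∉S , j∉S) ◅ w) {d} d∈S =
    cong₂ _xor_ (cong₂ _xor_ (off s∉S) (off j∉S)) (pathChain-outside w d∈S)
    where
    off : ∀ {a b} → a ∉ S → indicator a (src d) ∧ b ≡ false
    off {b = b} a∉S = cong (_∧ b) (indicator-≢ λ where refl → a∉S d∈S)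

-- Coboundaries of face colourings

module _ {G : Graph} (E : Embedding G) where
  open Graph G using (adj)

  coboundary : (Dart G → Bool) → Dart G → Bool
  coboundary χ d = χ d xor χ (rev d)

  coboundary-rev : ∀ χ d → coboundary χ (rev d) ≡ coboundary χ d
  coboundary-rev χ d = trans (cong (χ (rev d) xor_) (cong χ (rev-involutive d))) (xor-comm (χ (rev d)) (χ d))

  private
    module _ (u : Vertex G) where
      open Inverse (CyclicOrder.perm (rotation E u)) using (to; from; strictlyInverseˡ; strictlyInverseʳ)

      -- Taking the identity at non-neighbours makes the rotation at `u` a permutation of all
      -- vertices, under which sums over vertices are invariant.
      extendBy : (DartFrom G u → DartFrom G u) → Vertex G → Vertex G
      extendBy f v with T? (adj u v)
      ... | yes p = proj₁ (f (v , p))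
      ... | no _  = v

      extendBy-yes : ∀ f x → extendBy f (proj₁ x) ≡ proj₁ (f x)
      extendBy-yes f (v , p) with T? (adj u v)
      ... | yes q = cong (proj₁ ∘ f) (dartFrom-≡ {G} refl)
      ... | no ¬q = contradiction p ¬q

      extendBy-no : ∀ f {v} → ¬ T (adj u v) → extendBy f v ≡ v
      extendBy-no f {v} ¬p with T? (adj u v)
      ... | yes q = contradiction q ¬p
      ... | no _  = refl

      extendBy-inverse : ∀ f g → (∀ x → f (g x) ≡ x) → ∀ v → extendBy f (extendBy g v) ≡ v
      extendBy-inverse f g fg v = helper (T? (adj u v))
        where
        helper : Dec (T (adj u v)) → extendBy f (extendBy g v) ≡ v
        helper (yes p) = trans (cong (extendBy f) (extendBy-yes g (v , p)))
                               (trans (extendBy-yes f (g (v , p))) (cong proj₁ (fg (v , p))))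
        helper (no ¬p) = trans (cong (extendBy f) (extendBy-no g ¬p)) (extendBy-no f ¬p)

      entry-nx : ∀ χ v → entry (χ ∘ nx E) u v ≡ entry χ u (extendBy to v)
      entry-nx χ v with T? (adj u v) in eq
      ... | yes p = sym (entry-dart χ (nx E (dart u v p)))
      ... | no ¬p rewrite eq = refl

      sum-nx : ∀ χ → ∂ (χ ∘ nx E) u ≡ ∂ χ u
      sum-nx χ = trans (sum-cong-≗ (entry-nx χ)) (sym (sum-permute (entry χ u)
        (mk↔ₛ′ (extendBy to) (extendBy from) (extendBy-inverse to from strictlyInverseˡ)
                                             (extendBy-inverse from to strictlyInverseʳ))))

  -- For a face colouring, `χ ∘ rev` is `χ ∘ nx E`, and `nx E` permutes the darts at `u`; so the two
  -- halves of the coboundary have equal sums.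
  ∂-coboundary : ∀ {χ} → FaceColouring E χ → ∀ u → ∂ (coboundary χ) u ≡ false
  ∂-coboundary {χ} inv u = begin
    ∂ (coboundary χ) u        ≡⟨ ∂-xor χ (χ ∘ rev) u ⟩
    ∂ χ u xor ∂ (χ ∘ rev) u   ≡⟨ cong (∂ χ u xor_) (∂-cong (λ d → sym (colour-nx E {χ} inv d)) u) ⟩
    ∂ χ u xor ∂ (χ ∘ nx E) u  ≡⟨ cong (∂ χ u xor_) (sum-nx u χ) ⟩
    ∂ χ u xor ∂ χ u           ≡⟨ xor-same (∂ χ u) ⟩
    false                     ∎
    where open ≡-Reasoning

  -- Crossing an edge keeps the colour by the assumption on `χ`. Turning at a vertex keeps it too,
  -- since `χ (nx E d)` is `χ (rev d)`.
  colour-constant : ∀ {S χ} → FaceColouring E χ → (∀ d → χ d ≡ χ (rev d)) →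
    ∀ {u v} → Star (StepOutside G S) u v → ∀ {d d′} → src d ≡ u → src d′ ≡ v → χ d ≡ χ d′
  colour-constant {χ = χ} inv even ε eq eq′ =
    orbit-invariant (nx E) χ (λ d → trans (colour-nx E {χ} inv d) (sym (even d))) (nx-orbit E (trans eq (sym eq′)))
  colour-constant {S} {χ} inv even ((p , _) ◅ w) eq eq′ =
    trans (colour-constant {S} {χ} inv even ε eq refl)
      (trans (even (dart _ _ p)) (colour-constant {S} {χ} inv even w refl eq′))

-- Euler's formula and the cycle space

euler-characteristic-two : ∀ v e f → (+ 2 ℤ.- ((+ v ℤ.- + e) ℤ.+ + f)) ℚ./ 2 ≡ 0ℚ → v ℕ.+ f ≡ 2 ℕ.+ e
euler-characteristic-two v e f eq = ℤ.+-injective (begin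
  + v ℤ.+ + f                      ≡⟨ rearrange (+ v) (+ e) (+ f) ⟩
  (+ 2 ℤ.+ + e) ℤ.- numerator      ≡⟨ cong (λ z → (+ 2 ℤ.+ + e) ℤ.- z) numerator≡0 ⟩
  (+ 2 ℤ.+ + e) ℤ.- + 0            ≡⟨ ℤ.+-identityʳ _ ⟩
  + 2 ℤ.+ + e                      ∎)
  where
  open ≡-Reasoning
  rearrange : ∀ a b c → a ℤ.+ c ≡ (+ 2 ℤ.+ b) ℤ.- (+ 2 ℤ.- ((a ℤ.- b) ℤ.+ c))
  rearrange = ℤ-solve-∀
  numerator = + 2 ℤ.- ((+ v ℤ.- + e) ℤ.+ + f)
  numerator≡0 : numerator ≡ + 0
  numerator≡0 with /-injective-≃ (mkℚᵘ numerator 1) (mkℚᵘ (+ 0) 0) eq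
  ... | *≡* p = trans (sym (ℤ.*-identityʳ numerator)) p

module _ (G : Graph) where

  -- The list whose length is `edgeCount G`: restricted to it, chains become functions on
  -- `Fin (edgeCount G)`.
  increasing : List (Dart G)
  increasing = filter (λ d → src d Fin.<? tgt d) (darts G)

module _ {G : Graph} where

  increasing-complete : ∀ d → d L.∈ increasing G ⊎ rev d L.∈ increasing G
  increasing-complete d with Fin.<-cmp (src d) (tgt d)
  ... | tri< s<t _ _ = inj₁ (∈-filter⁺ _ (∈-darts d) s<t)
  ... | tri≈ _ s≡t _ = contradiction s≡t (src≢tgt d)
  ... | tri> _ _ t<s = inj₂ (∈-filter⁺ _ (∈-darts (rev d)) t<s)

  chains-agree : ∀ {Z W : Dart G → Bool} → (∀ d → Z (rev d) ≡ Z d) → (∀ d → W (rev d) ≡ W d) →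
                 (∀ i → Z (lookup (increasing G) i) ≡ W (lookup (increasing G) i)) → ∀ d → Z d ≡ W d
  chains-agree {Z} {W} Z-rev W-rev agree d =
    Sum.[ at , (λ r → trans (sym (Z-rev d)) (trans (at r) (W-rev d))) ]′ (increasing-complete d)
    where
    at : ∀ {d} → d L.∈ increasing G → Z d ≡ W d
    at d∈ = trans (cong Z (lookup-index d∈)) (trans (agree (index d∈)) (cong W (sym (lookup-index d∈))))

-- The domain of Ψ consists of face colourings vanishing on a base face and
-- of 0-chains avoiding a base vertex.  By Euler's formula its dimension is
-- the number of edges, and ∂ ∘ Ψ recovers the 0-chain; so Ψ is injective,
-- hence surjective, and a cycle is hit by a coboundary alone.
module _ {G : Graph} (connected : ∀ u v → Star (StepOutside G ∅ˢ) u v)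
         (E : Embedding G) {v′ f′ : ℕ} (order≡ : order G ≡ suc v′) (faces≡ : faceCount E ≡ suc f′)
         (euler : f′ ℕ.+ v′ ≡ edgeCount G) where

  private
    module V = Pointed (pointed order≡)
    module F = Pointed (pointed faces≡)

    colouring : (Fin (f′ ℕ.+ v′) → Bool) → Dart G → Bool
    colouring x d = F.extend (λ i → x (i ↑ˡ v′)) (faceIndex E d)

    colouring-face : ∀ x → FaceColouring E (colouring x)
    colouring-face x d = cong (F.extend _) (faceIndex-cong E (face-sym E (1 , refl)))

    path : Fin v′ → Dart G → Bool
    path j = pathChain (connected V.base (V.point j))

    paths : (Fin (f′ ℕ.+ v′) → Bool) → Dart G → Bool
    paths x d = sum λ j → x (f′ ↑ʳ j) ∧ path j d

    Ψ : (Fin (f′ ℕ.+ v′) → Bool) → Dart G → Bool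
    Ψ x d = coboundary E (colouring x) d xor paths x d

    Ψ-rev : ∀ x d → Ψ x (rev d) ≡ Ψ x d
    Ψ-rev x d = cong₂ _xor_ (coboundary-rev E (colouring x) d)
                            (sum-cong-≗ λ j → cong (x (f′ ↑ʳ j) ∧_) (pathChain-rev (connected V.base (V.point j)) d))

    -- Coboundaries have no boundary, and among the paths from the base vertex only the one to
    -- `V.point i` has boundary at `V.point i`.
    ∂-Ψ : ∀ x i → ∂ (Ψ x) (V.point i) ≡ x (f′ ↑ʳ i)
    ∂-Ψ x i = begin
      ∂ (Ψ x) (V.point i)
        ≡⟨ ∂-xor (coboundary E (colouring x)) (paths x) (V.point i) ⟩
      ∂ (coboundary E (colouring x)) (V.point i) xor ∂ (paths x) (V.point i)
        ≡⟨ cong₂ _xor_ (∂-coboundary E {colouring x} (colouring-face x) (V.point i))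
                        (∂-sum (λ j d → x (f′ ↑ʳ j) ∧ path j d) (V.point i)) ⟩
      sum (λ j → ∂ (λ d → x (f′ ↑ʳ j) ∧ path j d) (V.point i))
        ≡⟨ sum-cong-≗ summand ⟩
      sum (λ j → x (f′ ↑ʳ j) ∧ indicator (V.point j) (V.point i))
        ≡⟨ sum-single _ i (λ j j≢i → trans
              (cong (x (f′ ↑ʳ j) ∧_) (indicator-≢ (j≢i ∘ sym ∘ V.point-injective))) (∧-zeroʳ _)) ⟩
      x (f′ ↑ʳ i) ∧ indicator (V.point i) (V.point i)
        ≡⟨ cong (x (f′ ↑ʳ i) ∧_) (indicator-≡ {v = V.point i} refl) ⟩
      x (f′ ↑ʳ i) ∧ true
        ≡⟨ Bool.∧-identityʳ _ ⟩
      x (f′ ↑ʳ i) ∎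
      where
      open ≡-Reasoning
      summand : ∀ j → ∂ (λ d → x (f′ ↑ʳ j) ∧ path j d) (V.point i) ≡ x (f′ ↑ʳ j) ∧ indicator (V.point j) (V.point i)
      summand j = trans (∂-∧ (x (f′ ↑ʳ j)) (path j) (V.point i))
        (cong (x (f′ ↑ʳ j) ∧_) (trans (∂-pathChain (connected V.base (V.point j)) (V.point i))
          (cong (_xor indicator (V.point j) (V.point i)) (indicator-≢ (V.point≢base i)))))

    coordinates : ∀ {P : Fin (f′ ℕ.+ v′) → Set} → (∀ i → P (i ↑ˡ v′)) → (∀ j → P (f′ ↑ʳ j)) → ∀ k → P k
    coordinates {P} l r k with splitAt f′ k in eq
    ... | inj₁ i = subst P (splitAt⁻¹-↑ˡ eq) (l i)
    ... | inj₂ j = subst P (splitAt⁻¹-↑ʳ {f′} eq) (r j)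

    -- `∂` recovers the path coefficients, so the coboundaries agree as well. The difference `θ` of
    -- the colourings then has coboundary zero, hence is constant, and it vanishes on the base face.
    Ψ-injective : ∀ x y → Ψ x ≗ Ψ y → x ≗ y
    Ψ-injective x y eq = coordinates {λ k → x k ≡ y k} left right
      where
      open ≡-Reasoning
      right : ∀ j → x (f′ ↑ʳ j) ≡ y (f′ ↑ʳ j)
      right j = trans (sym (∂-Ψ x j)) (trans (∂-cong eq (V.point j)) (∂-Ψ y j))

      paths-≡ : ∀ d → paths x d ≡ paths y d
      paths-≡ d = sum-cong-≗ λ j → cong (_∧ path j d) (right j)

      xor-cancelʳ : ∀ {a b} c → a xor c ≡ b xor c → a ≡ b
      xor-cancelʳ {a} {b} false e = trans (sym (Bool.xor-identityʳ a)) (trans e (Bool.xor-identityʳ b))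
      xor-cancelʳ {false} {false} true e = refl
      xor-cancelʳ {true} {true} true e = refl

      δ-≡ : ∀ d → coboundary E (colouring x) d ≡ coboundary E (colouring y) d
      δ-≡ d = xor-cancelʳ (paths x d) (trans (eq d) (cong (coboundary E (colouring y) d xor_) (sym (paths-≡ d))))

      θ : Dart G → Bool
      θ d = colouring x d xor colouring y d

      θ-face : FaceColouring E θ
      θ-face d = cong₂ _xor_ (colouring-face x d) (colouring-face y d)

      θ-even : ∀ d → θ d ≡ θ (rev d)
      θ-even d = xor≡false⇒≡ (trans (interchange (colouring x d) (colouring y d) (colouring x (rev d)) (colouring y (rev d)))
                                     (≡⇒xor≡false (δ-≡ d)))

      baseDart = lookup (representatives E) F.base

      θ-base : θ baseDart ≡ false
      θ-base = cong₂ _xor_ (vanish x) (vanish y)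
        where
        vanish : ∀ z → colouring z baseDart ≡ false
        vanish z = trans (cong (F.extend _) (faceIndex-lookup E F.base)) (F.extend-base _)

      θ-zero : ∀ d → θ d ≡ false
      θ-zero d = trans (colour-constant E {χ = θ} θ-face θ-even (connected (src d) (src baseDart)) refl refl) θ-base

      left : ∀ i → x (i ↑ˡ v′) ≡ y (i ↑ˡ v′)
      left i = begin
        x (i ↑ˡ v′)      ≡⟨ value x ⟨
        colouring x face ≡⟨ xor≡false⇒≡ (θ-zero face) ⟩
        colouring y face ≡⟨ value y ⟩
        y (i ↑ˡ v′)      ∎
        where
        face = lookup (representatives E) (F.point i)
        value : ∀ z → colouring z face ≡ z (i ↑ˡ v′)
        value z = trans (cong (F.extend _) (faceIndex-lookup E (F.point i))) (F.extend-point _ i)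

  cycle-coboundary : ∀ Z → (∀ d → Z (rev d) ≡ Z d) → (∀ u → ∂ Z u ≡ false) →
    ∃ λ χ → FaceColouring E χ × (∀ d → coboundary E χ d ≡ Z d)
  cycle-coboundary Z Z-rev ∂Z = colouring x , colouring-face x , λ d → trans (sym (no-paths d)) (Ψx≡Z d)
    where
    restrict : (Dart G → Bool) → Fin (edgeCount G) → Bool
    restrict W i = W (lookup (increasing G) i)

    preimage : ∃ λ x → restrict (Ψ x) ≗ restrict Z
    preimage = injective⇒surjective-→Bool euler (restrict ∘ Ψ)
      (λ x y e → Ψ-injective x y (chains-agree (Ψ-rev x) (Ψ-rev y) e)) (restrict Z)

    x = proj₁ preimage

    Ψx≡Z : ∀ d → Ψ x d ≡ Z d
    Ψx≡Z = chains-agree (Ψ-rev x) Z-rev (proj₂ preimage)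

    -- By `∂-Ψ` the coefficient of a path is the boundary of `Z` at its end, which is zero for a
    -- cycle.
    no-summand : ∀ d j → x (f′ ↑ʳ j) ∧ path j d ≡ false
    no-summand d j = cong (_∧ path j d)
      (trans (sym (∂-Ψ x j)) (trans (∂-cong Ψx≡Z (V.point j)) (∂Z (V.point j))))

    no-paths : ∀ d → Ψ x d ≡ coboundary E (colouring x) d
    no-paths d = trans (cong (coboundary E (colouring x) d xor_) (sum-false (no-summand d)))
                       (Bool.xor-identityʳ (coboundary E (colouring x) d))

-- Consequences of 3-connectedness

∣p∪q∣≤∣p∣+∣q∣ : ∀ {n} (p q : Subset n) → ∣ p ∪ˢ q ∣ ≤ ∣ p ∣ ℕ.+ ∣ q ∣
∣p∪q∣≤∣p∣+∣q∣ []            []            = z≤n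
∣p∪q∣≤∣p∣+∣q∣ (inside  ∷ p) (outside ∷ q) = s≤s (∣p∪q∣≤∣p∣+∣q∣ p q)
∣p∪q∣≤∣p∣+∣q∣ (outside ∷ p) (outside ∷ q) = ∣p∪q∣≤∣p∣+∣q∣ p q
∣p∪q∣≤∣p∣+∣q∣ (outside ∷ p) (inside  ∷ q) =
  ℕ.≤-trans (s≤s (∣p∪q∣≤∣p∣+∣q∣ p q)) (ℕ.≤-reflexive (sym (ℕ.+-suc ∣ p ∣ ∣ q ∣)))
∣p∪q∣≤∣p∣+∣q∣ (inside  ∷ p) (inside  ∷ q) =
  s≤s (ℕ.≤-trans (∣p∪q∣≤∣p∣+∣q∣ p q) (ℕ.+-monoʳ-≤ ∣ p ∣ (ℕ.n≤1+n ∣ q ∣)))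

pair : ∀ {n} → Fin n → Fin n → Subset n
pair u v = ⁅ u ⁆ ∪ˢ ⁅ v ⁆

∣pair∣≤2 : ∀ {n} (u v : Fin n) → ∣ pair u v ∣ ≤ 2
∣pair∣≤2 u v = ℕ.≤-trans (∣p∪q∣≤∣p∣+∣q∣ ⁅ u ⁆ ⁅ v ⁆)
                         (ℕ.≤-reflexive (cong₂ ℕ._+_ (∣⁅x⁆∣≡1 u) (∣⁅x⁆∣≡1 v)))

∉-pair : ∀ {n} {u v w : Fin n} → w ≢ u → w ≢ v → w ∉ pair u v
∉-pair {u = u} {v} w≢u w≢v w∈ with x∈p∪q⁻ ⁅ u ⁆ ⁅ v ⁆ w∈
... | inj₁ w∈u = w≢u (x∈⁅y⁆⇒x≡y u w∈u)
... | inj₂ w∈v = w≢v (x∈⁅y⁆⇒x≡y v w∈v)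

inhabited⇒suc : ∀ {n} → Fin n → ∃ λ m → n ≡ suc m
inhabited⇒suc {suc m} _ = m , refl

module _ {n : ℕ} where
  open import Data.List.Membership.DecPropositional (Fin._≟_ {n}) using (_∈?_)

  fourth-element : 4 ≤ n → (a b c : Fin n) → ∃ λ w → w ≢ a × w ≢ b × w ≢ c
  fourth-element 4≤n a b c with any? (λ w → ¬? (w ∈? (a ∷ b ∷ c ∷ [])))
  ... | yes (w , w∉) = w , w∉ ∘ here , w∉ ∘ there ∘ here , w∉ ∘ there ∘ there ∘ here
  ... | no none = contradiction (ℕ.≤-trans 4≤n n≤3) λ { (s≤s (s≤s (s≤s ()))) }
    where
    n≤3 : n ≤ 3
    n≤3 = subst (_≤ 3) (length-tabulate id)
      (Unique-⊆⇒length≤ (Unique.allFin⁺ n)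
        λ {w} _ → decidable-stable (w ∈? (a ∷ b ∷ c ∷ [])) (none ∘ (w ,_)))

module _ {G : Graph} (3-connected : ThreeConnected G) where

  connected : ∀ u v → Star (StepOutside G ∅ˢ) u v
  connected u v = proj₂ 3-connected ∅ˢ (subst (_≤ 2) (sym (∣⊥∣≡0 (order G))) z≤n) u v ∉⊥ ∉⊥

  first-step : ∀ {S u w} → Star (StepOutside G S) u w → u ≢ w → ∃ λ (d : Dart G) → src d ≡ u × tgt d ∉ S
  first-step ε u≢w = contradiction refl u≢w
  first-step ((p , _ , v∉S) ◅ _) _ = dart _ _ p , refl , v∉S

  some-dart : Dart G
  some-dart = let r = Fin.fromℕ< (ℕ.≤-trans (s≤s z≤n) (proj₁ 3-connected))
                  w , w≢r , _ = fourth-element (proj₁ 3-connected) r r r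
              in proj₁ (first-step (connected r w) (w≢r ∘ sym))

  module _ (E : Embedding G) where

    -- Every vertex has degree at least 3: otherwise `a` and `nx E a` would be the only darts at
    -- their source, and deleting their targets would cut it off from a fourth vertex.
    nx∘nx≢ : ∀ a → nx E (nx E a) ≢ a
    nx∘nx≢ a nxnxa≡a
      with w , w≢u , w≢s , w≢t ← fourth-element (proj₁ 3-connected) (src a) (tgt a) (tgt (nx E a))
      with d , d-src , d-tgt ← first-step (proj₂ 3-connected (pair (tgt a) (tgt (nx E a)))
                                             (∣pair∣≤2 (tgt a) (tgt (nx E a)))
                                             (src a) w (∉-pair (src≢tgt a) (src≢tgt (nx E a))) (∉-pair w≢s w≢t))
                                          (w≢u ∘ sym)
      = d-tgt (in-pair (two (nx-orbit E {a} {d} (sym d-src))))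
      where
      two : ∀ {y} → SameOrbit (nx E) a y → y ≡ a ⊎ y ≡ nx E a
      two = orbit-ind (nx E) (λ y → y ≡ a ⊎ y ≡ nx E a) (inj₁ refl)
              λ { _ (inj₁ refl) → inj₂ refl ; _ (inj₂ refl) → inj₁ nxnxa≡a }
      in-pair : ∀ {y} → y ≡ a ⊎ y ≡ nx E a → tgt y ∈ pair (tgt a) (tgt (nx E a))
      in-pair (inj₁ refl) = x∈p∪q⁺ (inj₁ (x∈⁅x⁆ (tgt a)))
      in-pair (inj₂ refl) = x∈p∪q⁺ {p = ⁅ tgt a ⁆} (inj₂ (x∈⁅x⁆ (tgt (nx E a))))

    nx≢ : ∀ a → nx E a ≢ a
    nx≢ a eq = nx∘nx≢ a (trans (cong (nx E) eq) eq)

    faceNext≢rev : ∀ d → faceNext E d ≢ rev d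
    faceNext≢rev d = nx≢ (rev d)

  abstract
    -- The combinatorial Jordan curve theorem. Without the base face and the base vertex, Euler's
    -- formula reads `(f - 1) + (v - 1) = e`, as `cycle-coboundary` requires.
    planar-coboundary : (E : Embedding G) → genus E ≡ 0ℚ →
      ∀ Z → (∀ d → Z (rev d) ≡ Z d) → (∀ u → ∂ Z u ≡ false) →
      ∃ λ χ → FaceColouring E χ × (∀ d → coboundary E χ d ≡ Z d)
    planar-coboundary E genus≡0
      with v′ , order≡ ← inhabited⇒suc (src some-dart)
      with f′ , faces≡ ← inhabited⇒suc (faceIndex E some-dart)
      = cycle-coboundary connected E order≡ faces≡ (ℕ.suc-injective (ℕ.suc-injective (begin
          suc (suc (f′ ℕ.+ v′))       ≡⟨ cong suc (ℕ.+-suc f′ v′) ⟨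
          suc f′ ℕ.+ suc v′           ≡⟨ ℕ.+-comm (suc f′) (suc v′) ⟩
          suc v′ ℕ.+ suc f′           ≡⟨ cong₂ ℕ._+_ order≡ faces≡ ⟨
          order G ℕ.+ faceCount E     ≡⟨ euler-characteristic-two (order G) (edgeCount G) (faceCount E) genus≡0 ⟩
          suc (suc (edgeCount G))     ∎)))
      where
      open ≡-Reasoning

-- Faces as subgraphs

module _ {G : Graph} (E : Embedding G) where

  edge-ends : ∀ {D e} → edges (faceSubgraph E D) e →
              vertices (faceSubgraph E D) (src e) × vertices (faceSubgraph E D) (tgt e)
  edge-ends {e = e} (inj₁ D~e) = (e , D~e , refl) , (faceNext E e , orbit-step (faceNext E) D~e , refl)
  edge-ends {e = e} (inj₂ D~e) = (faceNext E (rev e) , orbit-step (faceNext E) D~e , refl) , (rev e , D~e , refl)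

  edges-rev : ∀ {D e} → edges (faceSubgraph E D) e → edges (faceSubgraph E D) (rev e)
  edges-rev {D} {e} (inj₁ D~e) = inj₂ (subst (SameFace E D) (sym (rev-involutive e)) D~e)
  edges-rev (inj₂ D~e) = inj₁ D~e

  vertex? : ∀ d u → Dec (vertices (faceSubgraph E d) u)
  vertex? d u = map′ (λ any → let e , _ , p = find any in e , p) (λ (e , p) → lose (∈-darts e) p)
    (Any.any? (λ e → sameFace? E d e ×-dec (src e Fin.≟ u)) (darts G))

  edge? : ∀ d e → Dec (edges (faceSubgraph E d) e)
  edge? d e = sameFace? E d e ⊎-dec sameFace? E d (rev e)

-- Facial walks

-- Orbits replace lists here: this is the working form of the condition that facial walks are simple
-- cycles.
SimpleFaces : ∀ {G} → Embedding G → Set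
SimpleFaces {G} E = ∀ {a b : Dart G} → SameFace E a b → src a ≡ src b → a ≡ b

All-iterate : ∀ {A : Set} {P : A → Set} (f : A → A) a n → (∀ k → k < n → P (fold a f k)) → All P (iterate f a n)
All-iterate f a zero    h = []
All-iterate {P = P} f a (suc n) h = h 0 (s≤s z≤n) ∷
  All-iterate f (f a) n λ k k<n → subst P (sym (fold-shift f a k)) (h (suc k) (s≤s k<n))

∈-iterate : ∀ {A : Set} (f : A → A) a {k n} → k < n → fold a f k L.∈ iterate f a n
∈-iterate f a {zero}  (s≤s _)   = here refl
∈-iterate f a {suc k} (s≤s k<n) = there (subst (L._∈ iterate f (f a) _) (fold-shift f a k) (∈-iterate f (f a) k<n))

Unique-map-injective : ∀ {A B : Set} (f : A → B) {xs a b} → Unique (map f xs) →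
                       a L.∈ xs → b L.∈ xs → f a ≡ f b → a ≡ b
Unique-map-injective f uniq       (here refl) (here refl) eq = refl
Unique-map-injective f (px ∷ _)   (here refl) (there b∈)  eq = contradiction eq (All.lookup px (L.∈-map⁺ f b∈))
Unique-map-injective f (px ∷ _)   (there a∈)  (here refl) eq = contradiction (sym eq) (All.lookup px (L.∈-map⁺ f a∈))
Unique-map-injective f (_ ∷ uniq) (there a∈)  (there b∈)  eq = Unique-map-injective f uniq a∈ b∈ eq

module _ {G : Graph} (E : Embedding G) where
  open import Data.List.Membership.DecPropositional (_≟ᵈ_ {G}) using (_∈?_)

  faceDarts : Dart G → List (Dart G)
  faceDarts d = filter (sameFace? E d) (darts G)

  ∈-faceDarts : ∀ {d y} → SameFace E d y → y L.∈ faceDarts d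
  ∈-faceDarts {d} {y} d~y = ∈-filter⁺ (sameFace? E d) (∈-darts y) d~y

  simpleCycles⇒simpleFaces : (∀ d → IsSimpleCycle (facialWalk E d)) → SimpleFaces E
  simpleCycles⇒simpleFaces cycles {a} {b} a~b eq =
    Unique-map-injective src (proj₂ (cycles a)) (in-walk (orbit-refl (faceNext E))) (in-walk a~b) eq
    where
    -- The walk lists `faceLength` distinct darts of a face that has `faceLength` darts; a dart
    -- missing from it would be one too many.
    in-walk : ∀ {y} → SameFace E a y → y L.∈ facialWalk E a
    in-walk {y} a~y with y ∈? facialWalk E a
    ... | yes y∈ = y∈
    ... | no y∉ = contradiction
      (subst (λ n → suc n ≤ faceLength E a) (length-iterate (faceNext E) a (faceLength E a))
        (Unique-⊆⇒length≤ (All.¬Any⇒All¬ _ y∉ ∷ Unique.map⁻ (proj₂ (cycles a))) λ where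
          (here refl) → ∈-faceDarts a~y
          (there z∈)  → All.lookup
            (All-iterate {P = L._∈ faceDarts a} (faceNext E) a (faceLength E a) λ k _ → ∈-faceDarts {a} (k , refl)) z∈))
      ℕ.1+n≰n

  simpleFaces⇒simpleCycles : ThreeConnected G → SimpleFaces E → ∀ d → IsSimpleCycle (facialWalk E d)
  simpleFaces⇒simpleCycles 3-connected simple d =
    subst (3 ≤_) (sym (length-iterate f d (faceLength E d))) 3≤length ,
    walk-unique d (faceLength E d) ℕ.≤-refl (orbit-refl f)
    where
    f = faceNext E

    step≢ : ∀ y → y ≢ f y
    step≢ y eq = src≢tgt y (cong src eq)

    -- Returning after two steps would mean going back along the same edge, hence a vertex of degree
    -- 1.
    two-steps≢ : ∀ y → y ≢ f (f y)
    two-steps≢ y eq = faceNext≢rev 3-connected E y (dart-≡ refl (sym (cong src eq)))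

    3≤length : 3 ≤ faceLength E d
    3≤length = Unique-⊆⇒length≤ {xs = d ∷ f d ∷ f (f d) ∷ []}
      ((step≢ d ∷ two-steps≢ d ∷ []) ∷ (step≢ (f d) ∷ []) ∷ [] ∷ []) λ where
        (here refl)                 → ∈-faceDarts (0 , refl)
        (there (here refl))         → ∈-faceDarts (1 , refl)
        (there (there (here refl))) → ∈-faceDarts (2 , refl)

    -- An early return would exhaust the face in fewer than `faceLength` steps.
    no-return : ∀ {a k} → SameFace E d a → suc k < faceLength E d → fold a f (suc k) ≢ a
    no-return {a} {k} d~a k<n per = ℕ.<⇒≱ k<n (subst (faceLength E d ≤_) (length-iterate f a (suc k))
      (Unique-⊆⇒length≤ (Unique.filter⁺ (sameFace? E d) darts-unique) λ y∈ →
        let r , r<k , eq = fold-< f k per (orbit-trans f (face-sym E d~a)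
                             (proj₂ (∈-filter⁻ (sameFace? E d) {xs = darts G} y∈)))
        in subst (L._∈ iterate f a (suc k)) eq (∈-iterate f a r<k)))

    walk-unique : ∀ a n → n ≤ faceLength E d → SameFace E d a → Unique (map src (iterate f a n))
    walk-unique a zero    _   _   = []
    walk-unique a (suc n) n<N d~a =
      All.map⁺ (All-iterate f (f a) n λ k k<n eq →
        no-return d~a (ℕ.≤-trans (s≤s k<n) n<N)
          (sym (simple (suc k , refl) (trans eq (cong src (fold-shift f a k))))))
      ∷ walk-unique (f a) n (ℕ.≤-trans (ℕ.n≤1+n n) n<N) (orbit-step f d~a)

-- The planar embedding is polyhedral

module _ {G : Graph} where

  along-≡ : ∀ (x : Dart G) → along x x ≡ true
  along-≡ x = cong₂ _∧_ (indicator-≡ {v = src x} refl) (indicator-≡ {v = tgt x} refl)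

  along-≢ : ∀ {x d : Dart G} → d ≢ x → along x d ≡ false
  along-≢ {x} {d} d≢x with src d Fin.≟ src x | tgt d Fin.≟ tgt x
  ... | yes s | yes t = contradiction (dart-≡ s t) d≢x
  ... | yes _ | no _  = refl
  ... | no _  | _     = refl

module _ {G : Graph} (3-connected : ThreeConnected G) (E : Embedding G) (genus≡0 : genus E ≡ 0ℚ) where

  -- The colouring comes from a cycle through x and y whose remaining part
  -- avoids S.
  separating-colouring : ∀ {S} → ∣ S ∣ ≤ 2 → ∀ x y → src x ≡ src y → src x ∈ S → tgt x ∉ S → tgt y ∉ S → x ≢ y →
    ∃ λ χ → FaceColouring E χ × (∀ d → src d ∈ S → d ≢ x → d ≢ y → χ (nx E d) ≡ χ d) × χ x ≢ χ y
  separating-colouring {S} ∣S∣≤2 x y x~y x∈S x⁺∉S y⁺∉S x≢y = χ , χ-face , unflipped , separated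
    where
    open ≡-Reasoning

    path : Star (StepOutside G S) (tgt x) (tgt y)
    path = proj₂ 3-connected S ∣S∣≤2 (tgt x) (tgt y) x⁺∉S y⁺∉S

    Z : Dart G → Bool
    Z d = edgeChain x d xor (pathChain path d xor edgeChain y d)

    Z-rev : ∀ d → Z (rev d) ≡ Z d
    Z-rev d = cong₂ _xor_ (edgeChain-rev x d) (cong₂ _xor_ (pathChain-rev path d) (edgeChain-rev y d))

    cancel : ∀ a b c → (a xor b) xor ((b xor c) xor (a xor c)) ≡ false
    cancel false false c     = xor-same c
    cancel false true  false = refl
    cancel false true  true  = refl
    cancel true  false false = refl
    cancel true  false true  = refl
    cancel true  true  false = refl
    cancel true  true  true  = refl

    ∂Z : ∀ u → ∂ Z u ≡ false
    ∂Z u = begin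
      ∂ Z u
        ≡⟨ ∂-xor (edgeChain x) (λ d → pathChain path d xor edgeChain y d) u ⟩
      ∂ (edgeChain x) u xor ∂ (λ d → pathChain path d xor edgeChain y d) u
        ≡⟨ cong₂ _xor_ (∂-edgeChain x u) (trans (∂-xor (pathChain path) (edgeChain y) u)
             (cong₂ _xor_ (∂-pathChain path u) (∂-edgeChain y u))) ⟩
      (i (src x) xor i (tgt x)) xor ((i (tgt x) xor i (tgt y)) xor (i (src y) xor i (tgt y)))
        ≡⟨ cong (λ s → (i (src x) xor i (tgt x)) xor ((i (tgt x) xor i (tgt y)) xor (i s xor i (tgt y)))) x~y ⟨
      (i (src x) xor i (tgt x)) xor ((i (tgt x) xor i (tgt y)) xor (i (src x) xor i (tgt y)))
        ≡⟨ cancel (i (src x)) (i (tgt x)) (i (tgt y)) ⟩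
      false ∎
      where
      i : Vertex G → Bool
      i v = indicator v u

    solution = planar-coboundary 3-connected E genus≡0 Z Z-rev ∂Z

    χ : Dart G → Bool
    χ = proj₁ solution

    χ-face : FaceColouring E χ
    χ-face = proj₁ (proj₂ solution)

    δχ≡Z : ∀ d → coboundary E χ d ≡ Z d
    δχ≡Z = proj₂ (proj₂ solution)

    edgeChain-at : ∀ e {d} → tgt e ∉ S → src d ∈ S → edgeChain e d ≡ along e d
    edgeChain-at e {d} e⁺∉S d∈S = trans
      (cong (along e d xor_) (along-≢ {x = rev e} {d} λ where refl → e⁺∉S d∈S))
      (Bool.xor-identityʳ (along e d))

    -- The path avoids `S`, and the reversals of `x` and `y` start outside `S`; only `x` and `y`
    -- themselves remain.
    Z-at : ∀ {d} → src d ∈ S → Z d ≡ along x d xor along y d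
    Z-at {d} d∈S = cong₂ _xor_ (edgeChain-at x {d} x⁺∉S d∈S)
                           (cong₂ _xor_ (pathChain-outside path d∈S) (edgeChain-at y {d} y⁺∉S d∈S))

    unflipped : ∀ d → src d ∈ S → d ≢ x → d ≢ y → χ (nx E d) ≡ χ d
    unflipped d d∈S d≢x d≢y = trans (colour-nx E {χ} χ-face d) (sym (xor≡false⇒≡ (begin
      χ d xor χ (rev d)        ≡⟨ δχ≡Z d ⟩
      Z d                      ≡⟨ Z-at d∈S ⟩
      along x d xor along y d  ≡⟨ cong₂ _xor_ (along-≢ d≢x) (along-≢ d≢y) ⟩
      false                    ∎)))

    flipped : χ (nx E x) ≡ not (χ x)
    flipped = trans (colour-nx E {χ} χ-face x) (xor≡true⇒≡not (begin
      χ x xor χ (rev x)        ≡⟨ δχ≡Z x ⟩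
      Z x                      ≡⟨ Z-at x∈S ⟩
      along x x xor along y x  ≡⟨ cong₂ _xor_ (along-≡ x) (along-≢ x≢y) ⟩
      true                     ∎))

    -- If χ x ≡ χ y, then no dart of the other colour is flipped, so turning
    -- around the vertex from nx E x one never gets back to x.
    separated : χ x ≢ χ y
    separated χx≡χy = not-¬ refl (proj₂ (orbit-ind (nx E)
      (λ d → src d ≡ src x × χ d ≡ not (χ x)) (refl , flipped)
      (λ { {d} _ (d~x , χd) → d~x , trans
        (unflipped d (subst (_∈ S) (sym d~x) x∈S)
          (λ where refl → not-¬ refl χd)
          (λ where refl → not-¬ (sym χx≡χy) χd))
        χd })
      (nx-orbit E {nx E x} {x} refl)))

  -- A cycle leaving the vertex through `a` and `b` would give these darts different colours,
  -- although they lie on one face.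
  planar-simpleFaces : SimpleFaces E
  planar-simpleFaces {a} {b} a~b eq with a ≟ᵈ b
  ... | yes a≡b = a≡b
  ... | no a≢b
    with χ , χ-face , _ , χa≢χb ←
         separating-colouring {⁅ src a ⁆} (ℕ.≤-trans (ℕ.≤-reflexive (∣⁅x⁆∣≡1 (src a))) (s≤s z≤n))
           a b eq (x∈⁅x⁆ (src a)) (λ a⁺∈ → src≢tgt a (sym (x∈⁅y⁆⇒x≡y _ a⁺∈)))
           (λ b⁺∈ → src≢tgt b (sym (trans (x∈⁅y⁆⇒x≡y _ b⁺∈) eq))) a≢b
    = contradiction (orbit-invariant (faceNext E) χ χ-face a~b) χa≢χb

  -- No cycle avoiding v separates the corners at u of two faces meeting at
  -- v, so that the part of the rotation at u between these corners consists
  -- of a dart to v.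
  private
    Between : Dart G → Dart G → Vertex G → Set
    Between a a′ v = tgt a ≡ v × nx E a ≡ a′

    module _ {a a′ b b′ : Dart G} (a~b : SameFace E a b) (a′~b′ : SameFace E a′ b′)
             (aa′ : src a ≡ src a′) (bb′ : src b ≡ src b′) (u≢v : src a ≢ src b) where

      at-u : ∀ {d : Dart G} → src d ≡ src a → src d ∈ pair (src a) (src b)
      at-u du = x∈p∪q⁺ (inj₁ (subst (_∈ ⁅ src a ⁆) (sym du) (x∈⁅x⁆ (src a))))

      at-v : ∀ {d : Dart G} → src d ≡ src b → src d ∈ pair (src a) (src b)
      at-v dv = x∈p∪q⁺ {p = ⁅ src a ⁆} (inj₂ (subst (_∈ ⁅ src b ⁆) (sym dv) (x∈⁅x⁆ (src b))))

      -- Let u be `src a` and v be `src b`. A cycle through `x` and `y` at u that avoids v leaves a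
      -- single colour around v, and the two faces carry it from `b` and `b′` to `a` and `a′`. If
      -- this forces `x` and `y` to have equal colours, the cycle fails to separate them.
      colours-agree : ∀ {x y} → src x ≡ src a → src y ≡ src a → tgt x ≢ src b → tgt y ≢ src b → x ≢ y →
        (∀ χ → FaceColouring E χ → (∀ d → src d ≡ src a → d ≢ x → d ≢ y → χ (nx E d) ≡ χ d) → χ a ≡ χ a′ → χ x ≡ χ y) → ⊥
      colours-agree {x} {y} xu yu x⁺≢v y⁺≢v x≢y agree
        with χ , χ-face , unflipped , χx≢χy ←
               separating-colouring {pair (src a) (src b)} (∣pair∣≤2 (src a) (src b)) x y (trans xu (sym yu))
               (at-u {x} xu) (∉-pair (λ e → src≢tgt x (trans xu (sym e))) x⁺≢v)
               (∉-pair (λ e → src≢tgt y (trans yu (sym e))) y⁺≢v) x≢y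
        = χx≢χy (agree χ χ-face (λ d du → unflipped d (at-u {d} du)) (begin
            χ a   ≡⟨ orbit-invariant (faceNext E) χ χ-face a~b ⟩
            χ b   ≡⟨ proj₂ (orbit-ind (nx E) (λ d → src d ≡ src b × χ b ≡ χ d) (refl , refl)
                       (λ { {d} _ (dv , χd) → dv , trans χd (sym (unflipped d (at-v {d} dv)
                           (λ where refl → u≢v (trans (sym xu) dv)) (λ where refl → u≢v (trans (sym yu) dv)))) })
                       (nx-orbit E bb′)) ⟩
            χ b′  ≡⟨ orbit-invariant (faceNext E) χ χ-face a′~b′ ⟨
            χ a′  ∎))
        where
        open ≡-Reasoning

    between-first : ∀ {a a′ b b′} → SameFace E a b → SameFace E a′ b′ → ¬ SameFace E a a′ →
      src a ≡ src a′ → src b ≡ src b′ → src a ≢ src b → tgt a ≡ src b → nx E a ≡ a′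
    between-first {a} {a′} {b} {b′} a~b a′~b′ a≁a′ aa′ bb′ u≢v a⁺≡v with nx E a ≟ᵈ a′
    ... | yes eq = eq
    -- The dart `a` ends at v, so the cycle uses `nx E a` in its place; this dart has the colour of
    -- `a`, because `a` is not on the cycle.
    ... | no nxa≢a′ = ⊥-elim (colours-agree a~b a′~b′ aa′ bb′ u≢v {nx E a} {a′} refl (sym aa′)
        (λ e → nx≢ 3-connected E a (dart-≡ refl (trans e (sym a⁺≡v))))
        (λ e → a≢a′ (dart-≡ aa′ (trans a⁺≡v (sym e))))
        nxa≢a′
        (λ χ _ unflipped χa≡χa′ → trans (unflipped a refl (nx≢ 3-connected E a ∘ sym) a≢a′) χa≡χa′))
      where
      a≢a′ : a ≢ a′
      a≢a′ refl = a≁a′ (orbit-refl (faceNext E))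

    between : ∀ {a a′ b b′} → SameFace E a b → SameFace E a′ b′ → ¬ SameFace E a a′ →
      src a ≡ src a′ → src b ≡ src b′ → src a ≢ src b → Between a a′ (src b) ⊎ Between a′ a (src b)
    between {a} {a′} {b} {b′} a~b a′~b′ a≁a′ aa′ bb′ u≢v with tgt a Fin.≟ src b | tgt a′ Fin.≟ src b
    ... | yes e | _     = inj₁ (e , between-first a~b a′~b′ a≁a′ aa′ bb′ u≢v e)
    ... | no _  | yes e = inj₂ (e , between-first a′~b′ a~b (a≁a′ ∘ face-sym E) (sym aa′) (sym bb′)
                                      (λ eq → u≢v (trans aa′ (trans eq (sym bb′)))) (trans e bb′))
    -- Neither dart ends at v, so a cycle avoiding v can pass through both and would separate them.
    ... | no n  | no n′ = ⊥-elim (colours-agree a~b a′~b′ aa′ bb′ u≢v {a} {a′} refl (sym aa′) n n′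
        (λ where refl → a≁a′ (orbit-refl (faceNext E)))
        (λ _ _ _ χa≡χa′ → χa≡χa′))

  -- Intersections of two faces of the planar embedding

  module _ {d d′ : Dart G} (d≁d′ : ¬ SameFace E d d′) where
    private
      I = faceSubgraph E d ∩ᴳ faceSubgraph E d′

      apart : ∀ {a a′} → SameFace E d a → SameFace E d′ a′ → ¬ SameFace E a a′
      apart d~a d′~a′ a~a′ = d≁d′ (orbit-trans (faceNext E) d~a (orbit-trans (faceNext E) a~a′ (face-sym E d′~a′)))

      common : ∀ {a b a′ b′} → SameFace E d a → SameFace E d b → SameFace E d′ a′ → SameFace E d′ b′ →
               src a ≡ src a′ → src b ≡ src b′ → src a ≢ src b → Between a a′ (src b) ⊎ Between a′ a (src b)
      common d~a d~b d′~a′ d′~b′ = between (orbit-trans (faceNext E) (face-sym E d~a) d~b)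
                                           (orbit-trans (faceNext E) (face-sym E d′~a′) d′~b′) (apart d~a d′~a′)

      -- Either one dart leads to both `v` and `w`, or the corners at `u` succeed each other in both
      -- directions, which degree at least 3 excludes.
      at-most-two : ∀ {u v w} → vertices I u → vertices I v → vertices I w → u ≢ v → u ≢ w → v ≡ w
      at-most-two ((a , d~a , refl) , (a′ , d~a′ , aa′)) ((b , d~b , refl) , (b′ , d~b′ , bb′))
                  ((c , d~c , refl) , (c′ , d~c′ , cc′)) u≢v u≢w
        with common d~a d~b d~a′ d~b′ (sym aa′) (sym bb′) u≢v
           | common d~a d~c d~a′ d~c′ (sym aa′) (sym cc′) u≢w
      ... | inj₁ (v , _) | inj₁ (w , _) = trans (sym v) w
      ... | inj₂ (v , _) | inj₂ (w , _) = trans (sym v) w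
      ... | inj₁ (_ , refl) | inj₂ (_ , eq) = contradiction eq (nx∘nx≢ 3-connected E a)
      ... | inj₂ (_ , refl) | inj₁ (_ , eq) = contradiction eq (nx∘nx≢ 3-connected E a′)

      common-edge : ∀ {u v} → vertices I u → vertices I v → u ≢ v →
                    ∃ λ e → src e ≡ u × tgt e ≡ v × edges I e
      common-edge ((a , d~a , refl) , (a′ , d~a′ , aa′)) ((b , d~b , refl) , (b′ , d~b′ , bb′)) u≢v
        with common d~a d~b d~a′ d~b′ (sym aa′) (sym bb′) u≢v
      ... | inj₁ (a⁺ , refl) = a , refl , a⁺ , inj₁ d~a , inj₂ (orbit-trans (faceNext E) d~a′ (rev-nx-face E a))
      ... | inj₂ (a⁺ , refl) = a′ , aa′ , a⁺ , inj₂ (orbit-trans (faceNext E) d~a (rev-nx-face E a′)) , inj₁ d~a′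

      common? : ∀ u → Dec (vertices I u)
      common? u = vertex? E d u ×-dec vertex? E d′ u

    -- The number of common vertices decides: none, one, or two that `common-edge` joins.
    face-intersection : I ≐ᴳ emptySubgraph ⊎ (∃ λ u → I ≐ᴳ singleVertex u) ⊎ (∃ λ e → I ≐ᴳ singleEdge e)
    face-intersection with any? common?
    ... | no none = inj₁ (((λ {u} u∈ → none (u , u∈)) , λ ()) ,
                          ((λ {e} (e∈ , e∈′) → none (src e , proj₁ (edge-ends E e∈) , proj₁ (edge-ends E e∈′))) , λ ()))
    ... | yes (u , u∈) with any? (λ v → ¬? (v Fin.≟ u) ×-dec common? v)
    ... | no none = inj₂ (inj₁ (u , ((λ {v} v∈ → sym (only v∈)) , λ where refl → u∈) ,
            ((λ {e} (e∈ , e∈′) → src≢tgt e (trans (only (proj₁ (edge-ends E e∈) , proj₁ (edge-ends E e∈′)))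
                                             (sym (only (proj₂ (edge-ends E e∈) , proj₂ (edge-ends E e∈′)))))) , λ ())))
      where
      only : ∀ {v} → vertices I v → v ≡ u
      only {v} v∈ = decidable-stable (v Fin.≟ u) λ v≢u → none (v , v≢u , v∈)
    ... | yes (v , v≢u , v∈) with e , refl , refl , e∈ ← common-edge u∈ v∈ (v≢u ∘ sym)
      = inj₂ (inj₂ (e , (only , λ { (inj₁ refl) → u∈ ; (inj₂ refl) → v∈ }) , (only-edge ,
          λ { (inj₁ refl) → e∈ ; (inj₂ refl) → edges-rev E (proj₁ e∈) , edges-rev E (proj₂ e∈) })))
      where
      only : ∀ {w} → vertices I w → src e ≡ w ⊎ tgt e ≡ w
      only {w} w∈ with src e Fin.≟ w
      ... | yes eq = inj₁ eq
      ... | no u≢w = inj₂ (at-most-two u∈ v∈ w∈ (v≢u ∘ sym) u≢w)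
      only-edge : ∀ {x} → edges I x → e ≡ x ⊎ rev e ≡ x
      only-edge {x} (x∈ , x∈′)
        with only (proj₁ (edge-ends E x∈) , proj₁ (edge-ends E x∈′))
           | only (proj₂ (edge-ends E x∈) , proj₂ (edge-ends E x∈′))
      ... | inj₁ s | inj₂ t = inj₁ (dart-≡ s t)
      ... | inj₂ s | inj₁ t = inj₂ (dart-≡ s t)
      ... | inj₁ s | inj₁ t = contradiction (trans (sym s) t) (src≢tgt x)
      ... | inj₂ s | inj₂ t = contradiction (trans (sym s) t) (src≢tgt x)

  planar⇒polyhedral : Polyhedral E
  planar⇒polyhedral = simpleFaces⇒simpleCycles E 3-connected planar-simpleFaces , λ d d′ → face-intersection

-- Uniqueness

module _ {G : Graph} (E : Embedding G) where

  nx-mirror : ∀ d → nx E (nx (mirror E) d) ≡ d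
  nx-mirror (dart u v p) =
    cong (λ (w , q) → dart u w q) (Inverse.strictlyInverseˡ (CyclicOrder.perm (rotation E u)) (v , p))

  mirror-nx : ∀ d → nx (mirror E) (nx E d) ≡ d
  mirror-nx (dart u v p) =
    cong (λ (w , q) → dart u w q) (Inverse.strictlyInverseʳ (CyclicOrder.perm (rotation E u)) (v , p))

  -- A simple face has only two edges at the source of its dart `y`: that of `y`, and the one by
  -- which it arrives, whose outward dart precedes `y` in the rotation.
  edge-at-corner : SimpleFaces E → ∀ {d e y} → edges (faceSubgraph E d) e → SameFace E d y → src e ≡ src y →
                   e ≡ y ⊎ nx E e ≡ y
  edge-at-corner simple (inj₁ d~e) d~y eq = inj₁ (simple (orbit-trans (faceNext E) (face-sym E d~e) d~y) eq)
  edge-at-corner simple {d} {e} (inj₂ d~e⁻) d~y eq =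
    inj₂ (simple (orbit-trans (faceNext E) (rev-nx-face E e) (orbit-trans (faceNext E) (face-sym E d~e⁻) d~y)) eq)

  dart-connected : ThreeConnected G → (P : Dart G → Set) →
                   (∀ a → P a → P (nx E a)) → (∀ a → P a → P (rev (nx E a))) →
                   ∀ a → P a → ∀ b → P b
  dart-connected 3-connected P turn cross a Pa b = travel (connected {G} 3-connected (src a) (src b)) {a} {b} refl refl Pa
    where
    around : ∀ {x y} → src x ≡ src y → P x → P y
    around {x} {y} eq Px = orbit-ind (nx E) P Px (λ {z} _ → turn z) (nx-orbit E {x} {y} eq)
    travel : ∀ {S u v} → Star (StepOutside G S) u v → ∀ {x y} → src x ≡ u → src y ≡ v → P x → P y
    travel ε {x} {y} eq eq′ Px = around {x} {y} (trans eq (sym eq′)) Px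
    travel ((p , _) ◅ w) {x} {y} eq eq′ Px = travel w {rev d} {y} refl eq′
      -- `cross` moves from `a` to `rev (nx E a)`, so it is applied to the dart before `d` in the
      -- rotation.
      (subst (P ∘ rev) (nx-mirror d) (cross (nx (mirror E) d) (around {x} {nx (mirror E) d} eq Px)))
      where d = dart _ _ p

module _ {G : Graph} (E : Embedding G) (polyhedral : Polyhedral E) where

  abstract
    polyhedral-simpleFaces : SimpleFaces E
    polyhedral-simpleFaces = simpleCycles⇒simpleFaces E (proj₁ polyhedral)

  shared-edge : ∀ {d d′} → ¬ SameFace E d d′ → let I = faceSubgraph E d ∩ᴳ faceSubgraph E d′ in
    ∀ {u v} → vertices I u → vertices I v → u ≢ v → ∃ λ e → src e ≡ u × tgt e ≡ v × edges I e
  shared-edge d≁d′ {u} {v} u∈ v∈ u≢v with proj₂ polyhedral _ _ d≁d′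
  ... | inj₁ ((empty , _) , _) = ⊥-elim (empty {u} u∈)
  ... | inj₂ (inj₁ (_ , (only , _) , _)) = contradiction (trans (sym (only u∈)) (only v∈)) u≢v
  ... | inj₂ (inj₂ (e , (ends , _) , (_ , e∈))) with ends u∈ | ends v∈
  ...   | inj₁ s | inj₂ t = e , s , t , e∈ (inj₁ refl)
  ...   | inj₂ s | inj₁ t = rev e , s , t , e∈ (inj₂ refl)
  ...   | inj₁ s | inj₁ t = contradiction (trans (sym s) t) u≢v
  ...   | inj₂ s | inj₂ t = contradiction (trans (sym s) t) u≢v

module _ {G : Graph} (3-connected : ThreeConnected G) (E₀ : Embedding G) (genus≡0 : genus E₀ ≡ 0ℚ)
         (E : Embedding G) (polyhedral : Polyhedral E) where

  private
    simple : SimpleFaces E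
    simple = polyhedral-simpleFaces E polyhedral

    f f₀ : Dart G → Dart G
    f  = faceNext E
    f₀ = faceNext E₀

  -- Local forms of `E₀` being equal to `E` and of `E₀` being the mirror image of `E`.
  Agrees Reverses : Dart G → Set
  Agrees   a = nx E₀ a ≡ nx E a
  Reverses a = nx E₀ (nx E a) ≡ a

  private
    -- The reversal is taken because `Agrees (rev d)` amounts to `f₀ d ≡ f d` and `Reverses (rev d)`
    -- to `nx E₀ (f d) ≡ rev d`: `E₀` follows the face forwards or backwards.
    Along : Dart G → (Dart G → Set) → Set
    Along g P = ∀ d → SameFace E g d → P (rev d)

  -- Here χ is a face colouring of E₀ whose coboundary is the face F of E
  -- through g₀, and H is the set of darts of F in both orientations.
  module _ (g₀ : Dart G) (χ : Dart G → Bool) (χ-face : FaceColouring E₀ χ)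
           (χ-off : ∀ {d} → ¬ edges (faceSubgraph E g₀) d → χ d ≡ χ (rev d))
           (χ-on : ∀ {d} → SameFace E g₀ d → χ (rev d) ≡ not (χ d)) where
    private
      F H : Dart G → Set
      F = SameFace E g₀
      H = edges (faceSubgraph E g₀)

      OnF : Vertex G → Set
      OnF = vertices (faceSubgraph E g₀)

      not-on : ∀ {x} {A : Set} → ¬ H x → H x ⊎ A → A
      not-on ¬Hx = Sum.[ (λ Hx → contradiction Hx ¬Hx) , id ]′

      -- No edge of F ends at this vertex, so the colour is the same on both sides of each of its
      -- edges.
      χ-around : ∀ {d d′} → ¬ OnF (src d) → src d ≡ src d′ → χ d ≡ χ d′
      χ-around {d} {d′} off eq = proj₂ (orbit-ind (nx E₀) (λ y → src y ≡ src d × χ d ≡ χ y) (refl , refl)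
        (λ { {y} _ (yd , χy) → yd , trans χy (trans
           (χ-off λ Hy → off (subst OnF yd (proj₁ (edge-ends E Hy))))
           (sym (colour-nx E₀ {χ} χ-face y))) })
        (nx-orbit E₀ {d} {d′} eq))

      -- The face through y₀ only meets F in src y₀ and in at most one edge.
      χ-along-face : ∀ {y₀} → OnF (src y₀) → ¬ H y₀ → ∀ {y} → SameFace E y₀ y → H y ⊎ χ y ≡ χ y₀
      χ-along-face {y₀} on ¬Hy₀ = orbit-ind f (λ y → H y ⊎ χ y ≡ χ y₀) (inj₂ refl) step
        where
        step : ∀ {y} → SameFace E y₀ y → H y ⊎ χ y ≡ χ y₀ → H (f y) ⊎ χ (f y) ≡ χ y₀
        step {y} y₀~y cases with vertex? E g₀ (tgt y) | tgt y Fin.≟ src y₀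
        ... | no off | _ = inj₂ (trans (χ-around {f y} {rev y} off refl) (trans (sym (χ-off ¬Hy)) (not-on ¬Hy cases)))
          where
          ¬Hy : ¬ H y
          ¬Hy Hy = off (proj₂ (edge-ends E Hy))
        ... | yes _ | yes eq = inj₂ (cong χ (simple (orbit-trans f (face-sym E (orbit-step f y₀~y)) (orbit-refl f)) eq))
        ... | yes on′ | no t≢
          with e , es , et , e∈ , e∈′ ← shared-edge E polyhedral {g₀} {y₀} (¬Hy₀ ∘ inj₁)
                 (on′ , (f y , orbit-step f y₀~y , refl)) (on , (y₀ , orbit-refl f , refl)) t≢
          with edge-at-corner E simple {y₀} e∈′ (orbit-step f y₀~y) es
        ... | inj₁ refl = inj₁ e∈
        ... | inj₂ eq with refl ← nx-injective E {e} {rev y} eq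
          = contradiction (subst H (trans (rev-involutive y) (sym y₀≡y)) (edges-rev E e∈)) ¬Hy₀
          where
          y₀≡y : y₀ ≡ y
          y₀≡y = simple y₀~y (sym et)

      H-at : ∀ {g x} → F g → src x ≡ src g → H x → x ≡ g ⊎ nx E x ≡ g
      H-at Fg eq Hx = edge-at-corner E simple Hx Fg eq

      -- The darts of F at this vertex are `g` and the one before it, so degree at least 3 puts the
      -- dart after `g` off F.
      ¬H-nx : ∀ {g} → F g → ¬ H (nx E g)
      ¬H-nx {g} Fg H⁺ with H-at Fg refl H⁺
      ... | inj₁ eq = nx≢ 3-connected E g eq
      ... | inj₂ eq = nx∘nx≢ 3-connected E g eq

      χ-nx : ∀ {x} → OnF (src x) → ¬ H x → ¬ H (nx E x) → χ (nx E x) ≡ χ x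
      χ-nx {x} on ¬Hx ¬Hx⁺ with χ-along-face on ¬Hx⁺ (rev-nx-face E x)
      ... | inj₁ Hx⁻ = contradiction (subst H (rev-involutive x) (edges-rev E Hx⁻)) ¬Hx
      ... | inj₂ eq  = trans (sym eq) (sym (χ-off ¬Hx))

      -- Turning from `nx E g`, the colour is kept by `χ-nx` until the two consecutive darts of F
      -- are met; after them the turn is back at `nx E g`.
      χ-at : ∀ {g} → F g → ∀ {x} → src x ≡ src g → ¬ H x → χ x ≡ χ (nx E g)
      χ-at {g} Fg {x} eq ¬Hx = not-on ¬Hx (proj₂ (orbit-ind (nx E) P (refl , inj₂ refl) (λ {y} _ → step {y})
                                                    (nx-orbit E {nx E g} {x} (sym eq))))
        where
        P : Dart G → Set
        P y = src y ≡ src g × (H y ⊎ χ y ≡ χ (nx E g))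
        step : ∀ {y} → P y → P (nx E y)
        step {y} (yg , cases) with edge? E g₀ (nx E y) | edge? E g₀ y
        ... | yes Hy⁺ | _ = yg , inj₁ Hy⁺
        ... | no ¬Hy⁺ | no ¬Hy = yg , inj₂ (trans (χ-nx (g , Fg , sym yg) ¬Hy ¬Hy⁺)
                                                     (not-on ¬Hy cases))
        ... | no ¬Hy⁺ | yes Hy with H-at Fg yg Hy
        ...   | inj₁ refl = yg , inj₂ refl
        ...   | inj₂ refl = contradiction (inj₁ Fg) ¬Hy⁺

      -- The face of `E` across `g` runs through `rev z`, `rev g` and `nx E g`, where `z` precedes
      -- `rev g` in the rotation. It carries the colour from one end of `g` to the other.
      χ-next : ∀ {g} → F g → χ (nx E (f g)) ≡ χ (nx E g)
      χ-next {g} Fg = begin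
        χ (nx E (f g))  ≡⟨ χ-at (orbit-step f Fg) refl ¬Hz ⟨
        χ z             ≡⟨ χ-off ¬Hz ⟩
        χ (rev z)       ≡⟨ not-on ¬Hz⁻ (χ-along-face (g , Fg , refl) (¬H-nx Fg) nxg~z⁻) ⟩
        χ (nx E g)      ∎
        where
        open ≡-Reasoning
        z = nx (mirror E) (rev g)
        nxz≡g⁻ : nx E z ≡ rev g
        nxz≡g⁻ = nx-mirror E (rev g)
        nxg~z⁻ : SameFace E (nx E g) (rev z)
        nxg~z⁻ = orbit-trans f (rev-nx-face E g) (subst (λ h → SameFace E h (rev z)) nxz≡g⁻ (rev-nx-face E z))
        ¬Hz : ¬ H z
        ¬Hz Hz with H-at (orbit-step f Fg) refl Hz
        ... | inj₁ eq = nx∘nx≢ 3-connected E (rev g) (trans (cong (nx E) (sym eq)) nxz≡g⁻)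
        ... | inj₂ eq = nx≢ 3-connected E (rev g) (trans (sym eq) nxz≡g⁻)
        ¬Hz⁻ : ¬ H (rev z)
        ¬Hz⁻ Hz⁻ = ¬Hz (subst H (rev-involutive z) (edges-rev E Hz⁻))

      β : Bool
      β = χ (nx E g₀)

      χ-nx-face : ∀ {g} → F g → χ (nx E g) ≡ β
      χ-nx-face = orbit-ind f (λ g → χ (nx E g) ≡ β) refl (λ Fg eq → trans (χ-next Fg) eq)

      -- A walk from F reaches every vertex. At vertices of F the colour is `β` by `χ-nx-face`;
      -- elsewhere it is inherited across the edge just walked.
      χ-off-face : ∀ {x} → ¬ H x → χ x ≡ β
      χ-off-face {x} = travel (connected {G} 3-connected (src g₀) (src x)) at-start refl
        where
        Good : Vertex G → Set
        Good v = ∀ {y} → src y ≡ v → ¬ H y → χ y ≡ β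

        good-on : ∀ {v} → OnF v → Good v
        good-on (g , Fg , refl) eq ¬Hy = trans (χ-at Fg eq ¬Hy) (χ-nx-face Fg)

        at-start : Good (src g₀)
        at-start = good-on (g₀ , orbit-refl f , refl)

        travel : ∀ {S u v} → Star (StepOutside G S) u v → Good u → Good v
        travel ε good = good
        travel {v = v} (_◅_ {j = j} (p , _) w) good = travel w good-next
          where
          d = dart _ _ p
          good-next : Good j
          good-next {y} eq ¬Hy with vertex? E g₀ j
          ... | yes on = good-on on eq ¬Hy
          ... | no off = trans (sym (χ-around {rev d} {y} off (sym eq))) (trans (sym (χ-off ¬Hd)) (good refl ¬Hd))
            where
            ¬Hd : ¬ H d
            ¬Hd Hd = off (proj₂ (edge-ends E Hd))

      black⇒H : ∀ {x} → χ x ≡ not β → H x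
      black⇒H {x} black = decidable-stable (edge? E g₀ x) λ ¬Hx → not-¬ (χ-off-face ¬Hx) black

      -- `f₀ d` has the colour of `d` and hence lies on F; there it can only be `f d` or the way
      -- back `rev d`, which is excluded.
      forward : ∀ {d} → F d → χ d ≡ not β → f₀ d ≡ f d
      forward {d} Fd black with H-at (orbit-step f Fd) refl (black⇒H (trans (χ-face d) black))
      ... | inj₁ eq = eq
      ... | inj₂ eq = contradiction (nx-injective E eq) (faceNext≢rev 3-connected E₀ d)

      backward : ∀ {d} → F d → χ (rev (f d)) ≡ not β → nx E₀ (f d) ≡ rev d
      backward {d} Fd black with H-at (orbit-step f Fd) refl
        (black⇒H (trans (colour-nx E₀ {χ} χ-face (f d)) black))
      ... | inj₁ eq = contradiction eq (nx≢ 3-connected E₀ (f d))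
      ... | inj₂ eq = nx-injective E eq

    -- Exactly one of `g₀` and `rev g₀` is black, that is, of colour `not β`. Its face in `E₀` stays
    -- black, and being black keeps it on F, forwards or backwards.
    agrees-or-reverses-along : Along g₀ Agrees ⊎ Along g₀ Reverses
    agrees-or-reverses-along with χ g₀ Bool.≟ β
    ... | no χg₀≢β = inj₁ λ _ Fd → forward Fd (all-black Fd)
      where
      all-black : ∀ {d} → F d → χ d ≡ not β
      all-black = orbit-ind f (λ d → χ d ≡ not β) (¬-not χg₀≢β)
        λ {y} Fy black → trans (cong χ (sym (forward Fy black))) (trans (χ-face y) black)
    ... | yes χg₀≡β = inj₂ λ _ Fd → backward Fd (all-black (orbit-step f Fd))
      where
      all-black : ∀ {d} → F d → χ (rev d) ≡ not β
      -- Blackness starts at `rev g₀` and moves against F, so the induction runs from `g₀` backwards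
      -- to `d`.
      all-black {d} Fd = orbit-ind-back f (λ y → χ (rev y) ≡ not β) (trans (χ-on (orbit-refl f)) (cong not χg₀≡β))
        (λ {y} d~y black → let Fy = orbit-trans f Fd d~y in
          trans (cong χ (sym (backward Fy black))) (trans (colour-nx E₀ {χ} χ-face (f y)) black))
        (face-sym E Fd)

  abstract
    -- The coboundary of the indicator `φ` of a face of `E` is a cycle, so it is also the coboundary
    -- of a colouring `χ` of the faces of `E₀`.
    face-agrees-or-reverses : ∀ g₀ → Along g₀ Agrees ⊎ Along g₀ Reverses
    face-agrees-or-reverses g₀ =
      let χ , χ-face , δχ≡δφ = planar-coboundary 3-connected E₀ genus≡0 (coboundary E φ) (coboundary-rev E φ)
                                 (∂-coboundary E {φ} φ-face)
      in agrees-or-reverses-along g₀ χ χ-face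
           (λ {d} ¬Hd → xor≡false⇒≡ (trans (δχ≡δφ d) (cong₂ _xor_ (φ-no (¬Hd ∘ inj₁)) (φ-no (¬Hd ∘ inj₂)))))
           (λ {d} Fd → xor≡true⇒≡not (trans (δχ≡δφ d) (cong₂ _xor_ (φ-yes Fd) (φ-no (not-both Fd)))))
      where
      F : Dart G → Set
      F = SameFace E g₀

      -- A simple face that used an edge in both directions would have to turn back at its end. So
      -- the coboundary of `φ` is `true` on F.
      not-both : ∀ {d} → F d → ¬ F (rev d)
      not-both {d} Fd Fd⁻ = faceNext≢rev 3-connected E d
        (simple (orbit-trans f (face-sym E (orbit-step f Fd)) Fd⁻) refl)

      φ : Dart G → Bool
      φ d = ⌊ sameFace? E g₀ d ⌋

      φ-yes : ∀ {d} → F d → φ d ≡ true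
      φ-yes {d} Fd = trans (isYes≗does (sameFace? E g₀ d)) (dec-true (sameFace? E g₀ d) Fd)

      φ-no : ∀ {d} → ¬ F d → φ d ≡ false
      φ-no {d} ¬Fd = trans (isYes≗does (sameFace? E g₀ d)) (dec-false (sameFace? E g₀ d) ¬Fd)

      φ-face : FaceColouring E φ
      φ-face d = helper (sameFace? E g₀ d)
        where
        helper : Dec (F d) → φ (f d) ≡ φ d
        helper (yes Fd) = trans (φ-yes (orbit-step f Fd)) (sym (φ-yes Fd))
        helper (no ¬Fd) = trans (φ-no (λ Ffd → ¬Fd (orbit-trans f Ffd (face-sym E (1 , refl))))) (sym (φ-no ¬Fd))

  -- Spreading the direction from one face to the whole graph

  private
    not-both-signs : ∀ a → Agrees a → ¬ Reverses a
    not-both-signs a agrees reverses = nx∘nx≢ 3-connected E₀ a (trans (cong (nx E₀) agrees) reverses)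

    -- The darts `rev a` and `nx E a` are consecutive on a face of `E`, along which the direction is
    -- constant.
    sign : ∀ a → (Agrees a × Agrees (rev (nx E a))) ⊎ (Reverses a × Reverses (rev (nx E a)))
    sign a = Sum.map (both Agrees) (both Reverses) (face-agrees-or-reverses (rev a))
      where
      both : ∀ P → Along (rev a) P → P a × P (rev (nx E a))
      both P s = subst P (rev-involutive a) (s (rev a) (orbit-refl f)) , s (nx E a) (1 , sym (nx-faceNext E a))

    -- A change of sign between `a` and `nx E a`, here and in `reverses-turn`, would make
    -- `nx E (nx E a)` equal to `a`, against degree at least 3.
    agrees-turn : ∀ a → Agrees a → Agrees (nx E a)
    agrees-turn a agrees with sign (nx E a)
    ... | inj₁ (agrees⁺ , _) = agrees⁺
    ... | inj₂ (reverses⁺ , _) = contradiction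
      (nx-injective E₀ (trans reverses⁺ (sym agrees))) (nx∘nx≢ 3-connected E a)

    reverses-turn : ∀ a → Reverses a → Reverses (nx E a)
    reverses-turn a reverses with sign (nx E a)
    ... | inj₁ (agrees⁺ , _) = contradiction (trans (sym agrees⁺) reverses) (nx∘nx≢ 3-connected E a)
    ... | inj₂ (reverses⁺ , _) = reverses⁺

    agrees-cross : ∀ a → Agrees a → Agrees (rev (nx E a))
    agrees-cross a agrees with sign a
    ... | inj₁ (_ , agrees⁺) = agrees⁺
    ... | inj₂ (reverses , _) = contradiction reverses (not-both-signs a agrees)

    reverses-cross : ∀ a → Reverses a → Reverses (rev (nx E a))
    reverses-cross a reverses with sign a
    ... | inj₁ (agrees , _) = contradiction reverses (not-both-signs a agrees)
    ... | inj₂ (_ , reverses⁺) = reverses⁺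

  abstract
    agrees-or-reverses : (∀ a → Agrees a) ⊎ (∀ a → Reverses a)
    agrees-or-reverses = Sum.map
      (λ (agrees , _) → dart-connected E 3-connected Agrees agrees-turn agrees-cross d agrees)
      (λ (reverses , _) → dart-connected E 3-connected Reverses reverses-turn reverses-cross d reverses)
      (sign d)
      where
      d : Dart G
      d = some-dart 3-connected

mainTheorem1 : (G : Graph) → ThreeConnected G → Planar G →
    (∃ λ (E : Embedding G) → Polyhedral E) ×
    ((E E′ : Embedding G) → Polyhedral E → Polyhedral E′ → Equivalent E E′)
mainTheorem1 G 3-connected (E₀ , genus≡0) = (E₀ , planar⇒polyhedral 3-connected E₀ genus≡0) , unique
  where
  unique : (E E′ : Embedding G) → Polyhedral E → Polyhedral E′ → Equivalent E E′
  unique E E′ polyhedral polyhedral′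
    with agrees-or-reverses 3-connected E₀ genus≡0 E polyhedral
       | agrees-or-reverses 3-connected E₀ genus≡0 E′ polyhedral′
  -- Both embeddings have been compared with `E₀`: equal signs make them identical, opposite signs
  -- make them mirror images.
  ... | inj₁ a | inj₁ a′ = inj₁ λ d → trans (sym (a d)) (a′ d)
  ... | inj₂ r | inj₂ r′ = inj₁ λ d → nx-injective E₀ (trans (r d) (sym (r′ d)))
  ... | inj₁ a | inj₂ r′ = inj₂ λ d → trans (sym (a d))
    (trans (cong (nx E₀) (sym (nx-mirror E′ d))) (r′ (nx (mirror E′) d)))
  ... | inj₂ r | inj₁ a′ = inj₂ λ d → trans (sym (mirror-nx E′ (nx E d)))
    (cong (nx (mirror E′)) (trans (sym (a′ (nx E d))) (r d)))
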